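{- Let $d\ge 2$. For every fixed $d$-ary tree $D$, the limit $$\eta_d(D)=\lim_{n\to\infty}\gamma(D,H_n^d)$$ exists. It can be determined recursively as follows: $\eta_d(D)=1$ when $D$ is empty or consists of a single vertex. Otherwise, if $D_1,D_2,\ldots,D_d$ are the branches of $D$ (some possibly empty), then $$\eta_d(D)=\binom{\|D\|}{\|D_1\|,\|D_2\|,\ldots,\|D_d\|}\,\frac{|M(D)|}{d^{\|D\|}-d}\,\prod_{i=1}^d\eta_d(D_i).$$ Moreover, $$\gamma(D,H_n^d)=\eta_d(D)+O(n^{ -1})$$ as $n\to\infty$, where the constant implied by the $O$-term depends only on $d$ and $D$.
   Context: A $d$-ary tree is a finite rooted tree in which every internal (non-leaf) vertex has at least two and at most $d$ children; a single vertex is a $d$-ary tree with one leaf, and the empty tree with $0$ leaves is also allowed. Isomorphism means root-preserving isomorphism (two empty trees are isomorphic). $\|T\|$ denotes the number of leaves of $T$. A set $S$ of leaves of $T$ induces a $d$-ary tree: take the smallest subtree of $T$ containing all leaves in $S$ (rooted at the most recent common ancestor of $S$) and repeatedly suppress every vertex with exactly one child (contracting its two adjacent edges to a single edge). $c(D,T)$ is the number of sets of $\|D\|$ leaves of $T$ that induce a tree isomorphic to $D$ (with $c(D,T)=1$ if $D$ is empty), and $\gamma(D,T)=c(D,T)/\binom{\|T\|}{\|D\|}$. The branches of a $d$-ary tree $D$ with at least two leaves are the components (rooted at the children of the root) obtained on removing the root; the list is padded with empty trees to have exactly $d$ entries $D_1,\ldots,D_d$. On the set of permutations of $[d]=\{1,\ldots,d\}$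 define $\pi\sim_D\pi'$ if $D_{\pi(j)}$ is isomorphic to $D_{\pi'(j)}$ for every $j\in[d]$; $M(D)$ is a complete set of representatives of the equivalence classes of $\sim_D$. The strictly $d$-ary trees $H_n^d$ ($n\ge 0$) are defined recursively: $H_0^d$ is a single leaf; for $n>0$ write $n-1=ds+b$ with $b\in\{0,1,\ldots,d-1\}$, take $d-b$ copies of $H_s^d$ and $b$ copies of $H_{s+1}^d$, and connect a new common root to each of their roots by an edge to obtain $H_n^d$. The tree $H_n^d$ has $(d-1)n+1$ leaves. -}

module Defs where

open import Data.Fin using (Fin; zero; suc; toℕ; punchIn)
open import Data.Fin.Properties using (all?)
open import Data.Fin.Permutation using (Permutation′; _⟨$⟩ʳ_; insert; remove; insert-remove)
  renaming (_≈_ to _≗ₚ_; id to idₚ)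
open import Data.Fin.Subset using (Subset; inside; outside; ∣_∣)
import Data.Integer as ℤ
open import Data.List using (List; []; _∷_; _++_; concatMap; drop; filter; fromMaybe; head; length; map; replicate; allFin; deduplicate)
open import Data.List.Membership.Propositional.Properties using (∈-allFin)
open import Data.List.Relation.Binary.Permutation.Homogeneous as Perm using (Permutation)
open import Data.List.Relation.Binary.Pointwise using (Pointwise; []; _∷_)
open import Data.List.Relation.Unary.All using (All)
open import Data.List.Relation.Unary.Any using (Any; here; there; _─_; any?) renaming (map to mapAny)
open import Data.List.Relation.Unary.Any.Properties using (¬Any[]; concatMap⁺; map⁺)
import Data.List.Relation.Unary.Enumerates.Setoid as Enumerates
import Data.List.Relation.Unary.Unique.Setoid as Unique
import Data.List.Relation.Unary.Unique.DecSetoid.Properties as UniqueDec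
import Data.List.Relation.Unary.Enumerates.Setoid.Properties as EnumeratesP
open import Data.Maybe as Maybe using (Maybe; just; nothing; maybe′)
open import Data.Maybe.Relation.Binary.Pointwise as MP using (just; nothing) renaming (Pointwise to MaybeRel)
open import Data.Maybe.Relation.Unary.All using () renaming (All to MaybeAll)
open import Data.Nat using (ℕ; zero; suc; _+_; _*_; _∸_; _≤_; _<_; _≟_; NonZero; NonTrivial; nonTrivial⇒nonZero; nonTrivial⇒n>1; z≤n; s≤s)
open import Data.Nat.Base using (_!)
open import Data.Nat.Combinatorics using (_C_)
open import Data.Nat.DivMod using (_/_; _%_; m/n≤m; m/n<m; m%n<n; m≡m%n+[m/n]*n; [m+kn]%n≡m%n; m<n⇒m%n≡m; m<n⇒m/n≡0; m*n/n≡m; +-distrib-/-∣ˡ)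
open import Data.Nat.Divisibility using (m∣m*n)
open import Data.Nat.Properties using (≤-refl; ≤-trans; <-≤-trans; *-comm; +-comm; +-identityʳ)
open import Data.Product using (_×_; _,_; ∃-syntax)
import Data.Rational as ℚ
open ℚ using (ℚ; 0ℚ; 1ℚ)
open import Data.Vec using ([]; _∷_) renaming (take to takeᵛ; drop to dropᵛ)
open import Data.Vec.Functional using (Vector; foldr)
open import Function using (_∘_)
open import Relation.Binary using (Rel; Setoid; DecSetoid; IsEquivalence; Decidable)
open import Relation.Binary.PropositionalEquality using (_≡_; refl; sym; trans; cong; cong₂)
open import Relation.Nullary using (yes; no; _×-dec_)
open import Relation.Nullary.Decidable using (map′)
open import Level using (0ℓ)

infix 4 _≅_ _≅?_ _≅∅_ _≅∅?_ _⟶_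
infixl 7 _÷_

-- The order of the children is an artefact of the
-- representation and is disregarded by _≅_.

data Tree : Set where
  node : List Tree → Tree

pattern leaf = node []

-- nothing stands for the empty tree.
Tree∅ : Set
Tree∅ = Maybe Tree

data Dary (d : ℕ) : Tree → Set where
  single   : Dary d leaf
  internal : ∀ {ts} → 2 ≤ length ts → length ts ≤ d → All (Dary d) ts → Dary d (node ts)

Dary∅ : ℕ → Tree∅ → Set
Dary∅ d = MaybeAll (Dary d)

mutual
  leaves : Tree → ℕ
  leaves leaf            = 1
  leaves (node (t ∷ ts)) = leaves* (t ∷ ts)

  leaves* : List Tree → ℕ
  leaves* []       = 0
  leaves* (t ∷ ts) = leaves t + leaves* ts

‖_‖ : Tree∅ → ℕ
‖_‖ = maybe′ leaves 0

data _≅_ : Rel Tree 0ℓ where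
  node≅ : ∀ {ts us} → Permutation _≅_ ts us → node ts ≅ node us

_≅∅_ : Rel Tree∅ 0ℓ
_≅∅_ = MaybeRel _≅_

mutual
  ≅-refl : ∀ t → t ≅ t
  ≅-refl (node ts) = node≅ (Perm.refl (≅-refl* ts))

  ≅-refl* : ∀ ts → Pointwise _≅_ ts ts
  ≅-refl* []       = []
  ≅-refl* (t ∷ ts) = ≅-refl t ∷ ≅-refl* ts

mutual
  ≅-sym : ∀ {t u} → t ≅ u → u ≅ t
  ≅-sym (node≅ p) = node≅ (↭-sym p)

  ↭-sym : ∀ {ts us} → Permutation _≅_ ts us → Permutation _≅_ us ts
  ↭-sym (Perm.refl es)     = Perm.refl (≅-sym* es)
  ↭-sym (Perm.prep e p)    = Perm.prep (≅-sym e) (↭-sym p)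
  ↭-sym (Perm.swap e f p)  = Perm.swap (≅-sym f) (≅-sym e) (↭-sym p)
  ↭-sym (Perm.trans p q)   = Perm.trans (↭-sym q) (↭-sym p)

  ≅-sym* : ∀ {ts us} → Pointwise _≅_ ts us → Pointwise _≅_ us ts
  ≅-sym* []       = []
  ≅-sym* (e ∷ es) = ≅-sym e ∷ ≅-sym* es

≅-trans : ∀ {t u v} → t ≅ u → u ≅ v → t ≅ v
≅-trans (node≅ p) (node≅ q) = node≅ (Perm.trans p q)

≅-isEquivalence : IsEquivalence _≅_
≅-isEquivalence = record { refl = ≅-refl _ ; sym = ≅-sym ; trans = ≅-trans }

≅-setoid : Setoid 0ℓ 0ℓ
≅-setoid = record { isEquivalence = ≅-isEquivalence }

open import Data.List.Relation.Binary.Permutation.Setoid.Properties ≅-setoid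
  using (∈-resp-↭; drop-∷)

private
  ↭-─ : ∀ {t us} (p : Any (t ≅_) us) → Permutation _≅_ (t ∷ (us ─ p)) us
  ↭-─ (here e)          = Perm.prep e (Perm.refl (≅-refl* _))
  ↭-─ {us = u ∷ us} (there p) =
    Perm.trans (Perm.swap (≅-refl _) (≅-refl _) (Perm.refl (≅-refl* _)))
               (Perm.prep (≅-refl _) (↭-─ p))

mutual
  _≅?_ : Decidable _≅_
  node ts ≅? node us = map′ node≅ (λ { (node≅ p) → p }) (ts ↭? us)

  _↭?_ : Decidable (Permutation _≅_)
  []       ↭? []       = yes (Perm.refl [])
  []       ↭? (u ∷ us) = no λ p → ¬Any[] (∈-resp-↭ (↭-sym p) (here (≅-refl u)))
  (t ∷ ts) ↭? us with any? (t ≅?_) us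
  ... | no  ¬p = no λ q → ¬p (∈-resp-↭ q (here (≅-refl t)))
  ... | yes p  = map′ (λ q → Perm.trans (Perm.prep (≅-refl t) q) (↭-─ p))
                      (λ q → drop-∷ (Perm.trans q (↭-sym (↭-─ p))))
                      (ts ↭? (us ─ p))

_≅∅?_ : Decidable _≅∅_
_≅∅?_ = MP.dec _≅?_

-- Leaves are numbered from left to right.

-- The union of the paths from the root to the leaves in S.
mutual
  span : (t : Tree) → Subset (leaves t) → Tree∅
  span leaf            (inside  ∷ []) = just leaf
  span leaf            (outside ∷ []) = nothing
  span (node (t ∷ ts)) S with span* (t ∷ ts) S
  ... | []       = nothing
  ... | (u ∷ us) = just (node (u ∷ us))

  span* : (ts : List Tree) → Subset (leaves* ts) → List Tree
  span* []       _ = []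
  span* (t ∷ ts) S = fromMaybe (span t (takeᵛ (leaves t) S)) ++ span* ts (dropᵛ (leaves t) S)

-- In span t S every leaf belongs to S, so the most recent common ancestor
-- of S is the first vertex, going down from the root, that does not have
-- exactly one child.
descend : Tree → Tree
descend (node (t ∷ [])) = descend t
descend t               = t

mutual
  suppress : Tree → Tree
  suppress (node (t ∷ [])) = suppress t
  suppress (node ts)       = node (suppress* ts)

  suppress* : List Tree → List Tree
  suppress* []       = []
  suppress* (t ∷ ts) = suppress t ∷ suppress* ts

induced : (t : Tree) → Subset (leaves t) → Tree∅
induced t S = Maybe.map (suppress ∘ descend) (span t S)

subsets : ∀ n → List (Subset n)
subsets zero    = [] ∷ []
subsets (suc n) = map (inside ∷_) (subsets n) ++ map (outside ∷_) (subsets n)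

c : Tree∅ → Tree → ℕ
c D T = length (filter (λ S → (∣ S ∣ ≟ ‖ D ‖) ×-dec (induced T S ≅∅? D)) (subsets (leaves T)))

-- m / n with the dummy value 0 at n = 0.  In γ D (H d n) the divisor is
-- nonzero for all large n, and in the formula for η it is always nonzero.
_÷_ : ℕ → ℕ → ℚ
m ÷ zero      = 0ℚ
m ÷ n@(suc _) = ℤ.+ m ℚ./ n

γ : Tree∅ → Tree → ℚ
γ D T = c D T ÷ (leaves T C ‖ D ‖)

-- Past the end of the list of children, head (drop _ _) is nothing, the padding.
branches : ∀ d → Tree → Vector Tree∅ d
branches d (node ts) i = head (drop (toℕ i) ts)

module _ {d : ℕ} (B : Vector Tree∅ d) where

  ∼-decSetoid : DecSetoid 0ℓ 0ℓ
  ∼-decSetoid = record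
    { Carrier          = Permutation′ d
    ; _≈_              = λ π π′ → ∀ j → B (π ⟨$⟩ʳ j) ≅∅ B (π′ ⟨$⟩ʳ j)
    ; isDecEquivalence = record
      { isEquivalence = record
        { refl  = λ j → MP.refl (≅-refl _)
        ; sym   = λ p j → MP.sym ≅-sym (p j)
        ; trans = λ p q j → MP.trans ≅-trans (p j) (q j)
        }
      ; _≟_ = λ π π′ → all? (λ j → B (π ⟨$⟩ʳ j) ≅∅? B (π′ ⟨$⟩ʳ j))
      }
    }

  ∼-setoid : Setoid 0ℓ 0ℓ
  ∼-setoid = DecSetoid.setoid ∼-decSetoid

  IsCompleteSetOfRepresentatives : List (Permutation′ d) → Set
  IsCompleteSetOfRepresentatives M =
    Unique.Unique ∼-setoid M × Enumerates.IsEnumeration ∼-setoid M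

permutations : ∀ d → List (Permutation′ d)
permutations zero    = idₚ ∷ []
permutations (suc d) = concatMap (λ i → map (insert zero i) (permutations d)) (allFin (suc d))

private
  insert-cong : ∀ {d} (i : Fin (suc d)) {π ρ : Permutation′ d} → π ≗ₚ ρ → insert zero i π ≗ₚ insert zero i ρ
  insert-cong i e zero    = refl
  insert-cong i e (suc k) = cong (punchIn i) (e k)

permutations-complete : ∀ d (π : Permutation′ d) → Any (π ≗ₚ_) (permutations d)
permutations-complete zero    π = here λ ()
permutations-complete (suc d) π =
  concatMap⁺ _ (mapAny (λ { refl → map⁺ (mapAny step (permutations-complete d (remove zero π))) })
                            (∈-allFin (π ⟨$⟩ʳ zero)))
  where
  step : ∀ {ρ} → remove zero π ≗ₚ ρ → π ≗ₚ insert zero (π ⟨$⟩ʳ zero) ρ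
  step {ρ} e k = trans (sym (insert-remove zero π k))
                       (insert-cong (π ⟨$⟩ʳ zero) {remove zero π} {ρ} e k)

representatives : ∀ {d} (B : Vector Tree∅ d) → ∃[ M ] IsCompleteSetOfRepresentatives B M
representatives {d} B = deduplicate (DecSetoid._≟_ S) (permutations d) ,
  UniqueDec.deduplicate-! S (permutations d) ,
  EnumeratesP.deduplicate⁺ S (λ π → mapAny (λ e j → MP.reflexive (λ { refl → ≅-refl _ }) (cong B (e j))) (permutations-complete d π))
  where S = ∼-decSetoid B

-- build f n is H d n as soon as n ≤ f; f only bounds the recursion depth.
-- H-zero and H-suc below are the defining recursion.
module _ (d : ℕ) .{{_ : NonTrivial d}} where

  private instance
    d≢0 : NonZero d
    d≢0 = nonTrivial⇒nonZero d

  build : ℕ → ℕ → Tree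
  build _       zero    = leaf
  build zero    (suc _) = leaf
  build (suc f) (suc m) =
    node (replicate (d ∸ m % d) (build f (m / d)) ++ replicate (m % d) (build f (suc (m / d))))

  H : ℕ → Tree
  H n = build n n

  private
    %<⇒≢0 : ∀ m {b} → m % d ≡ suc b → NonZero m
    %<⇒≢0 zero    eq with () ← trans (sym eq) (m<n⇒m%n≡m (<-≤-trans (s≤s z≤n) (nonTrivial⇒n>1 d)))
    %<⇒≢0 (suc _) _ = _

    build-H : ∀ f g n → n ≤ f → n ≤ g → build f n ≡ build g n
    build-H _       _       zero    _       _       = refl
    build-H (suc f) (suc g) (suc m) (s≤s p) (s≤s q) =
      cong₂ (λ xs ys → node (xs ++ ys))
        (cong (replicate (d ∸ m % d)) (build-H f g (m / d) (≤-trans (m/n≤m m d) p) (≤-trans (m/n≤m m d) q)))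
        (lem (m % d) refl)
      where
      lem : ∀ b → m % d ≡ b → replicate b (build f (suc (m / d))) ≡ replicate b (build g (suc (m / d)))
      lem zero    _  = refl
      lem (suc b) eq = cong (replicate (suc b)) (build-H f g (suc (m / d)) (≤-trans lt p) (≤-trans lt q))
        where
        instance _ = %<⇒≢0 m eq
        lt : m / d < m
        lt = m/n<m m d (nonTrivial⇒n>1 d)

  H-zero : H 0 ≡ leaf
  H-zero = refl

  H-suc : ∀ s b → b < d → H (suc (d * s + b)) ≡ node (replicate (d ∸ b) (H s) ++ replicate b (H (suc s)))
  H-suc s b b<d = trans (step (d * s + b)) (cong₂ (λ b s → node (replicate (d ∸ b) (H s) ++ replicate b (H (suc s)))) %≡ /≡)
    where
    step : ∀ m → H (suc m) ≡ node (replicate (d ∸ m % d) (H (m / d)) ++ replicate (m % d) (H (suc (m / d))))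
    step m = cong₂ (λ xs ys → node (xs ++ ys))
               (cong (replicate (d ∸ m % d)) (build-H m (m / d) (m / d) (m/n≤m m d) ≤-refl))
               (lem (m % d) refl)
      where
      lem : ∀ b → m % d ≡ b → replicate b (build m (suc (m / d))) ≡ replicate b (H (suc (m / d)))
      lem zero    _  = refl
      lem (suc b) eq = cong (replicate (suc b)) (build-H m _ (suc (m / d)) (m/n<m m d (nonTrivial⇒n>1 d)) ≤-refl)
        where instance _ = %<⇒≢0 m eq

    %≡ : (d * s + b) % d ≡ b
    %≡ = trans (cong (_% d) (trans (+-comm (d * s) b) (cong (b +_) (*-comm d s))))
               (trans ([m+kn]%n≡m%n b s d) (m<n⇒m%n≡m b<d))

    /≡ : (d * s + b) / d ≡ s
    /≡ = trans (+-distrib-/-∣ˡ b {d} (m∣m*n s))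
               (trans (cong₂ _+_ (trans (cong (_/ d) (*-comm d s)) (m*n/n≡m s d)) (m<n⇒m/n≡0 {b} {d} b<d)) (+-identityʳ s))

_⟶_ : (ℕ → ℚ) → ℚ → Set
f ⟶ l = ∀ ε → 0ℚ ℚ.< ε → ∃[ N ] (∀ n → N ≤ n → ℚ.∣ f n ℚ.- l ∣ ℚ.< ε)

IsO[1/n] : (ℕ → ℚ) → Set
IsO[1/n] f = ∃[ K ] ∃[ N ] (∀ n .{{_ : NonZero n}} → N ≤ n → ℚ.∣ f n ∣ ℚ.≤ K ℚ.* (ℤ.+ 1 ℚ./ n))

∏ : ∀ {k} → Vector ℚ k → ℚ
∏ = foldr ℚ._*_ 1ℚ

multinomial : ∀ {k} → ℕ → Vector ℕ k → ℚ
multinomial n ks = (n !) ÷ foldr _*_ 1 (λ i → ks i !)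

module Submission where

-- Splitting a set of leaves of a tree with root branches t₁, …, t_d according to the branches gives, for ‖D‖ ≥ 2,
--   c D T = Σ_j c D t_j + Σ_{π ∈ M(D)} Π_j c D_{π(j)} t_j.
-- Put x = ‖H_n‖, k = ‖D‖ and α = η(D)/k!.  The branches of H_n have x/d + O(1) leaves, so, the branches of D being
-- settled, the recursion determines α by (d^k − d) α = |M(D)| Π_i α(D_i), and the error e_n = |c D H_n / x^k − α|
-- satisfies e_n ≤ Σ_j e_j ρ_j^k + O(1/x), where ρ_j ≤ 2/3 is the proportion of leaves in branch j and e_j is the
-- error at that branch.  If e_j ≤ K/x_j at the branches, then, as ρ_j = x_j/x and Σ_j ρ_j = 1, the sum is at most
-- (K/x) Σ_j ρ_j^(k−1) ≤ (2/3) K/x for k ≥ 3, which gives e_n = O(1/x).  For k = 2 this would lose a logarithm, but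
-- there D is the cherry, which every pair of leaves induces.  Finally γ D H_n is k! c D H_n / x^k up to the factor
-- x^k / (k! C(x, k)) = 1 + O(1/x).

open import Defs
open import Algebra.Bundles using (CommutativeRing)
open import Data.Bool using (true; false; if_then_else_)
open import Data.Fin using (Fin; zero; suc; punchIn; toℕ)
open import Data.Fin.Permutation using (Permutation′; _⟨$⟩ʳ_; insert; remove; punchIn-permute) renaming (id to idₚ)
open import Data.Fin.Properties using (toℕ<n)
open import Data.List using (List; []; _∷_; _++_; length; map; filter; fromMaybe; catMaybes; tabulate; replicate; head; drop)
open import Data.List.Properties using (filter-++; length-++; length-replicate; length-tabulate; tabulate-cong; drop-[]; map-cong)
open import Data.List.Relation.Unary.All as All using (All; []; _∷_)
open import Data.List.Relation.Unary.AllPairs as AllPairs using (AllPairs; []; _∷_)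
open import Data.List.Relation.Unary.Any as Any using (Any; here; there)
open import Data.Maybe as Maybe using (just; nothing; maybe′)
open import Data.Maybe.Relation.Unary.All using (just; nothing) renaming (All to MaybeAll)
open import Data.Nat.Combinatorics using (_C_)
open import Data.Nat.ListAction using (sum)
open import Data.Product using (_×_; _,_; proj₁; proj₂; ∃-syntax; Σ-syntax)
open import Data.Sum using (_⊎_; inj₁; inj₂; [_,_]′)
open import Data.Vec.Functional using (Vector; foldr)
open import Function using (_∘_; id; _⇔_; mk⇔; Equivalence)
open import Relation.Binary as Binary using (Setoid; Rel)
open import Relation.Binary.PropositionalEquality
open import Relation.Nullary using (¬_; Dec; yes; no; does; _×-dec_; contradiction)
open import Relation.Unary using (Pred; Decidable)
open import Level using (0ℓ)

-- A set of leaves is recorded by its word: the list of the d trees, some of them empty, that it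
-- induces in the root branches. The parts of a set in different branches are chosen independently,
-- so the sets with a given word are counted by a product. A word whose nonempty letters are the
-- branches of D in some order agrees, up to isomorphism, with the word of one and only one
-- representative in M(D); this is why the recursion has a sum over M(D).
--
-- Errors are bounded by a constant times 1/x at every index, not just eventually. Sums and products
-- of such bounds need no thresholds, and the induction on the error can start at n = 0. A threshold
-- enters only in the last division, by k! C(x, k) / x^k, which vanishes for x < k.
--
-- The cherry has a known count, but its limit must still agree with the recursive formula, which
-- amounts to |M(D)| = C(d, 2).

module Counting where

  open import Data.Bool using (T)
  open import Data.Fin.Subset using (Subset; inside; outside; ∣_∣)
  import Data.List.Membership.Setoid as Membership
  open import Data.List.Relation.Binary.Permutation.Homogeneous as Perm using (Permutation)
  import Data.List.Relation.Binary.Permutation.Setoid.Properties as PermP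
  open import Data.List.Relation.Binary.Pointwise as PW using (Pointwise; []; _∷_)
  import Data.List.Relation.Unary.Any.Properties as AnyP
  import Data.List.Relation.Unary.Unique.Setoid as Unique
  open import Data.Maybe.Relation.Binary.Pointwise as MP using (just; nothing)
  open import Data.Nat
  open import Data.Nat.Combinatorics using (_P_; nCk+nC[k+1]≡[n+1]C[k+1]; nC1≡n; nCk≡nPk/k!; k>n⇒nCk≡0)
  open import Data.Nat.Combinatorics.Base using (_P′_)
  open import Data.Nat.Combinatorics.Specification using (k!∣nP′k)
  open import Data.Nat.DivMod
  open import Data.Nat.Properties
  open import Data.Nat.Solver using (module +-*-Solver)
  open import Data.Vec using ([]; _∷_) renaming (take to takeᵛ; drop to dropᵛ)
  open import Algebra.Properties.CommutativeSemigroup +-commutativeSemigroup using (x∙yz≈y∙xz) renaming (interchange to medial)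
  open Equivalence using (to; from)

  -- Counting

  ⟦_⟧ : ∀ {ℓ} {P : Set ℓ} → Dec P → ℕ
  ⟦ P? ⟧ = if does P? then 1 else 0

  module _ {p q} {P : Set p} {Q : Set q} where

    ⟦⟧-cong : {P? : Dec P} {Q? : Dec Q} → P ⇔ Q → ⟦ P? ⟧ ≡ ⟦ Q? ⟧
    ⟦⟧-cong {yes _} {yes _} e = refl
    ⟦⟧-cong {yes p} {no ¬q} e = contradiction (to e p) ¬q
    ⟦⟧-cong {no ¬p} {yes q} e = contradiction (from e q) ¬p
    ⟦⟧-cong {no _}  {no _}  e = refl

    ⟦⟧-* : ∀ {r} {R : Set r} {P? : Dec P} {Q? : Dec Q} {R? : Dec R} →
           P ⇔ (Q × R) → ⟦ P? ⟧ ≡ ⟦ Q? ⟧ * ⟦ R? ⟧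
    ⟦⟧-* {P? = yes p} {yes _} {yes _} e = refl
    ⟦⟧-* {P? = yes p} {yes _} {no ¬r} e = contradiction (proj₂ (to e p)) ¬r
    ⟦⟧-* {P? = yes p} {no ¬q} {_}     e = contradiction (proj₁ (to e p)) ¬q
    ⟦⟧-* {P? = no ¬p} {yes q} {yes r} e = contradiction (from e (q , r)) ¬p
    ⟦⟧-* {P? = no ¬p} {yes _} {no _}  e = refl
    ⟦⟧-* {P? = no ¬p} {no _}  {_}     e = refl

    ⟦⟧-+ : ∀ {r} {R : Set r} {P? : Dec P} {Q? : Dec Q} {R? : Dec R} →
           P ⇔ (Q ⊎ R) → ¬ (Q × R) → ⟦ P? ⟧ ≡ ⟦ Q? ⟧ + ⟦ R? ⟧
    ⟦⟧-+ {Q? = yes q} {yes r} e d = contradiction (q , r) d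
    ⟦⟧-+ {P? = yes p} {yes _} {no _}  e d = refl
    ⟦⟧-+ {P? = yes p} {no _}  {yes _} e d = refl
    ⟦⟧-+ {P? = yes p} {no ¬q} {no ¬r} e d = contradiction (to e p) [ ¬q , ¬r ]′
    ⟦⟧-+ {P? = no ¬p} {yes q} {_}     e d = contradiction (from e (inj₁ q)) ¬p
    ⟦⟧-+ {P? = no ¬p} {no _}  {yes r} e d = contradiction (from e (inj₂ r)) ¬p
    ⟦⟧-+ {P? = no _}  {no _}  {no _}  e d = refl

  ⟦⟧-no : ∀ {p} {P : Set p} {P? : Dec P} → ¬ P → ⟦ P? ⟧ ≡ 0
  ⟦⟧-no {P? = yes p} ¬p = contradiction p ¬p
  ⟦⟧-no {P? = no _}  ¬p = refl

  -- Pairwise exclusion lets at most one summand be 1. This turns "the word of some representative"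
  -- into a sum over `M`.
  ⟦⟧-Any : ∀ {a p q} {A : Set a} {P : Set p} {P? : Dec P} {Q : Pred A q} (Q? : Decidable Q) xs →
           P ⇔ Any Q xs → AllPairs (λ x y → ¬ (Q x × Q y)) xs → ⟦ P? ⟧ ≡ sum (map (λ x → ⟦ Q? x ⟧) xs)
  ⟦⟧-Any {P? = P?} Q? []       e _ = ⟦⟧-no {P? = P?} (λ p → case-[] (to e p))
    where
    case-[] : ¬ Any _ []
    case-[] ()
  ⟦⟧-Any {P? = P?} Q? (x ∷ xs) e (d ∷ ds) = trans
    (⟦⟧-+ {P? = P?} {Q? = Q? x} {R? = Any.any? Q? xs}
      (mk⇔ (Any.toSum ∘ to e) (from e ∘ Any.fromSum))
      (λ (q , a) → All.lookupWith (λ ¬qq q′ → ¬qq (q , q′)) d a))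
    (cong (⟦ Q? x ⟧ +_) (⟦⟧-Any {P? = Any.any? Q? xs} Q? xs (mk⇔ id id) ds))

  -- Summation by recursion on the vector instead of over the list `subsets n`, so that a splitting
  -- of the leaves can be followed by induction.
  Σ⊆ : ∀ n → (Subset n → ℕ) → ℕ
  Σ⊆ zero    f = f []
  Σ⊆ (suc n) f = Σ⊆ n (f ∘ (inside ∷_)) + Σ⊆ n (f ∘ (outside ∷_))

  Σ⊆-cong : ∀ n {f g : Subset n → ℕ} → (∀ S → f S ≡ g S) → Σ⊆ n f ≡ Σ⊆ n g
  Σ⊆-cong zero    e = e []
  Σ⊆-cong (suc n) e = cong₂ _+_ (Σ⊆-cong n (e ∘ (inside ∷_))) (Σ⊆-cong n (e ∘ (outside ∷_)))

  Σ⊆-0 : ∀ n → Σ⊆ n (λ _ → 0) ≡ 0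
  Σ⊆-0 zero    = refl
  Σ⊆-0 (suc n) = cong₂ _+_ (Σ⊆-0 n) (Σ⊆-0 n)

  Σ⊆-+ : ∀ n (f g : Subset n → ℕ) → Σ⊆ n (λ S → f S + g S) ≡ Σ⊆ n f + Σ⊆ n g
  Σ⊆-+ zero    f g = refl
  Σ⊆-+ (suc n) f g = trans (cong₂ _+_ (Σ⊆-+ n _ _) (Σ⊆-+ n _ _))
    (medial (Σ⊆ n (f ∘ (inside ∷_))) _ _ _)

  Σ⊆-sum : ∀ {a} {A : Set a} n (f : A → Subset n → ℕ) xs →
           Σ⊆ n (λ S → sum (map (λ x → f x S) xs)) ≡ sum (map (λ x → Σ⊆ n (f x)) xs)
  Σ⊆-sum n f []       = Σ⊆-0 n
  Σ⊆-sum n f (x ∷ xs) = trans (Σ⊆-+ n (f x) _) (cong (Σ⊆ n (f x) +_) (Σ⊆-sum n f xs))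

  Σ⊆-*ˡ : ∀ n k (f : Subset n → ℕ) → Σ⊆ n (λ S → k * f S) ≡ k * Σ⊆ n f
  Σ⊆-*ˡ zero    k f = refl
  Σ⊆-*ˡ (suc n) k f = trans (cong₂ _+_ (Σ⊆-*ˡ n k _) (Σ⊆-*ˡ n k _)) (sym (*-distribˡ-+ k (Σ⊆ n _) _))

  -- A subset of m + n leaves is a pair of subsets, so this is distributivity. All products over
  -- branches come from here.
  Σ⊆-* : ∀ m n (f : Subset m → ℕ) (g : Subset n → ℕ) →
         Σ⊆ (m + n) (λ S → f (takeᵛ m S) * g (dropᵛ m S)) ≡ Σ⊆ m f * Σ⊆ n g
  Σ⊆-* zero    n f g = Σ⊆-*ˡ n (f []) g
  Σ⊆-* (suc m) n f g = trans (cong₂ _+_ (Σ⊆-* m n _ g) (Σ⊆-* m n _ g))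
    (sym (*-distribʳ-+ (Σ⊆ n g) (Σ⊆ m _) _))

  length-filter-map : ∀ {a b p} {A : Set a} {B : Set b} {P : Pred B p} (P? : Decidable P) (f : A → B) xs →
                      length (filter P? (map f xs)) ≡ length (filter (P? ∘ f) xs)
  length-filter-map P? f []       = refl
  length-filter-map P? f (x ∷ xs) with does (P? (f x))
  ... | true  = cong suc (length-filter-map P? f xs)
  ... | false = length-filter-map P? f xs

  length-filter-subsets : ∀ {p} n {P : Pred (Subset n) p} (P? : Decidable P) →
                          length (filter P? (subsets n)) ≡ Σ⊆ n (λ S → ⟦ P? S ⟧)
  length-filter-subsets zero    P? with does (P? [])
  ... | true  = refl
  ... | false = refl
  length-filter-subsets (suc n) P? = trans
    (cong length (filter-++ P? (map (inside ∷_) (subsets n)) _))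
    (trans (length-++ (filter P? (map (inside ∷_) (subsets n))))
    (cong₂ _+_
      (trans (length-filter-map P? _ (subsets n)) (length-filter-subsets n (P? ∘ (inside ∷_))))
      (trans (length-filter-map P? _ (subsets n)) (length-filter-subsets n (P? ∘ (outside ∷_))))))

  Σ⊆-C : ∀ n k → Σ⊆ n (λ S → ⟦ ∣ S ∣ ≟ k ⟧) ≡ n C k
  Σ⊆-C zero    zero    = refl
  Σ⊆-C zero    (suc k) = refl
  Σ⊆-C (suc n) zero    = cong₂ _+_
    (trans (Σ⊆-cong n (λ S → ⟦⟧-no {P? = suc ∣ S ∣ ≟ 0} λ ())) (Σ⊆-0 n)) (Σ⊆-C n 0)
  Σ⊆-C (suc n) (suc k) = trans (cong₂ _+_
    (trans (Σ⊆-cong n (λ S → ⟦⟧-cong {P? = suc ∣ S ∣ ≟ suc k} {∣ S ∣ ≟ k} (mk⇔ suc-injective (cong suc)))) (Σ⊆-C n k))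
    (Σ⊆-C n (suc k)))
    (nCk+nC[k+1]≡[n+1]C[k+1] n k)

  -- Sizes

  leaves*-++ : ∀ ts us → leaves* (ts ++ us) ≡ leaves* ts + leaves* us
  leaves*-++ []       us = refl
  leaves*-++ (t ∷ ts) us = trans (cong (leaves t +_) (leaves*-++ ts us)) (sym (+-assoc (leaves t) _ _))

  ∣∣-take-drop : ∀ m {n} (S : Subset (m + n)) → ∣ S ∣ ≡ ∣ takeᵛ m S ∣ + ∣ dropᵛ m S ∣
  ∣∣-take-drop zero    S             = refl
  ∣∣-take-drop (suc m) (inside  ∷ S) = cong suc (∣∣-take-drop m S)
  ∣∣-take-drop (suc m) (outside ∷ S) = ∣∣-take-drop m S

  leaves*-fromMaybe : ∀ T → leaves* (fromMaybe T) ≡ ‖ T ‖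
  leaves*-fromMaybe (just T) = +-identityʳ (leaves T)
  leaves*-fromMaybe nothing  = refl

  mutual
    ‖span‖ : ∀ t S → ‖ span t S ‖ ≡ ∣ S ∣
    ‖span‖ leaf            (inside  ∷ []) = refl
    ‖span‖ leaf            (outside ∷ []) = refl
    ‖span‖ (node (t ∷ ts)) S with span* (t ∷ ts) S | leaves*-span* (t ∷ ts) S
    ... | []     | e = e
    ... | _ ∷ _  | e = e

    leaves*-span* : ∀ ts S → leaves* (span* ts S) ≡ ∣ S ∣
    leaves*-span* []       []= = sym (∣[]∣ []=)
      where
      ∣[]∣ : ∀ (S : Subset 0) → ∣ S ∣ ≡ 0
      ∣[]∣ [] = refl
    leaves*-span* (t ∷ ts) S = trans (leaves*-++ (fromMaybe (span t _)) _) (trans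
      (cong₂ _+_ (trans (leaves*-fromMaybe (span t _)) (‖span‖ t (takeᵛ (leaves t) S)))
                 (leaves*-span* ts (dropᵛ (leaves t) S)))
      (sym (∣∣-take-drop (leaves t) S)))

  mutual
    leaves-suppress : ∀ t → leaves (suppress t) ≡ leaves t
    leaves-suppress leaf                = refl
    leaves-suppress (node (t ∷ []))     = trans (leaves-suppress t) (sym (+-identityʳ _))
    leaves-suppress (node (t ∷ u ∷ ts)) = leaves-suppress* (t ∷ u ∷ ts)

    leaves-suppress* : ∀ ts → leaves* (suppress* ts) ≡ leaves* ts
    leaves-suppress* []       = refl
    leaves-suppress* (t ∷ ts) = cong₂ _+_ (leaves-suppress t) (leaves-suppress* ts)

  -- The unary vertices that `descend` skips at the top are contracted by `suppress` too. Expressed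
  -- by `suppress` and `span`, the induced tree can be computed branch by branch.
  suppress-descend : ∀ t → suppress (descend t) ≡ suppress t
  suppress-descend leaf                = refl
  suppress-descend (node (t ∷ []))     = suppress-descend t
  suppress-descend (node (t ∷ u ∷ ts)) = refl

  induced-span : ∀ t S → induced t S ≡ Maybe.map suppress (span t S)
  induced-span t S with span t S
  ... | nothing = refl
  ... | just u  = cong just (suppress-descend u)

  ‖induced‖ : ∀ t S → ‖ induced t S ‖ ≡ ∣ S ∣
  ‖induced‖ t S = trans (cong ‖_‖ (induced-span t S)) (trans (lem (span t S)) (‖span‖ t S))
    where
    lem : ∀ T → ‖ Maybe.map suppress T ‖ ≡ ‖ T ‖
    lem (just T) = leaves-suppress T
    lem nothing  = refl

  mutual
    ≅⇒leaves≡ : ∀ {t u} → t ≅ u → leaves t ≡ leaves u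
    ≅⇒leaves≡ {leaf}            {leaf}            (node≅ p) = refl
    ≅⇒leaves≡ {leaf}            {node (_ ∷ _)}    (node≅ p) = contradiction (PermP.xs↭ys⇒|xs|≡|ys| ≅-setoid p) λ ()
    ≅⇒leaves≡ {node (_ ∷ _)}    {leaf}            (node≅ p) = contradiction (PermP.xs↭ys⇒|xs|≡|ys| ≅-setoid p) λ ()
    ≅⇒leaves≡ {node (_ ∷ _)}    {node (_ ∷ _)}    (node≅ p) = ↭⇒leaves*≡ p

    ↭⇒leaves*≡ : ∀ {ts us} → Permutation _≅_ ts us → leaves* ts ≡ leaves* us
    ↭⇒leaves*≡ (Perm.refl es)       = ≋⇒leaves*≡ es
    ↭⇒leaves*≡ (Perm.prep e p)      = cong₂ _+_ (≅⇒leaves≡ e) (↭⇒leaves*≡ p)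
    ↭⇒leaves*≡ (Perm.swap {ys = us} {x′ = x′} {y′} e f p) = trans
      (cong₂ _+_ (≅⇒leaves≡ e) (cong₂ _+_ (≅⇒leaves≡ f) (↭⇒leaves*≡ p)))
      (x∙yz≈y∙xz (leaves x′) (leaves y′) (leaves* us))
    ↭⇒leaves*≡ (Perm.trans p q)     = trans (↭⇒leaves*≡ p) (↭⇒leaves*≡ q)

    ≋⇒leaves*≡ : ∀ {ts us} → Pointwise _≅_ ts us → leaves* ts ≡ leaves* us
    ≋⇒leaves*≡ []       = refl
    ≋⇒leaves*≡ (e ∷ es) = cong₂ _+_ (≅⇒leaves≡ e) (≋⇒leaves*≡ es)

  ≅∅⇒‖‖≡ : ∀ {T U} → T ≅∅ U → ‖ T ‖ ≡ ‖ U ‖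
  ≅∅⇒‖‖≡ (just e) = ≅⇒leaves≡ e
  ≅∅⇒‖‖≡ nothing  = refl

  leaves>0 : ∀ t → 0 < leaves t
  leaves>0 leaf            = s≤s z≤n
  leaves>0 (node (t ∷ ts)) = ≤-trans (leaves>0 t) (m≤m+n _ _)

  length≤leaves* : ∀ ts → length ts ≤ leaves* ts
  length≤leaves* []       = z≤n
  length≤leaves* (t ∷ ts) = +-mono-≤ (leaves>0 t) (length≤leaves* ts)

  -- The condition on the size of S in the definition of c is redundant.
  c≡Σ⊆ : ∀ D T → c D T ≡ Σ⊆ (leaves T) (λ S → ⟦ induced T S ≅∅? D ⟧)
  c≡Σ⊆ D T = trans (length-filter-subsets (leaves T) _) (Σ⊆-cong (leaves T) λ S →
    ⟦⟧-cong {P? = (∣ S ∣ ≟ ‖ D ‖) ×-dec (induced T S ≅∅? D)} {induced T S ≅∅? D}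
      (mk⇔ proj₂ λ e → trans (sym (‖induced‖ T S)) (≅∅⇒‖‖≡ e) , e))

  -- Trees with at most two leaves

  data Branching : Tree → Set where
    single   : Branching leaf
    internal : ∀ {ts} → 2 ≤ length ts → All Branching ts → Branching (node ts)

  mutual
    suppress-Branching : ∀ t → Branching (suppress t)
    suppress-Branching leaf                = single
    suppress-Branching (node (t ∷ []))     = suppress-Branching t
    suppress-Branching (node (t ∷ u ∷ ts)) = internal (s≤s (s≤s z≤n)) (suppress*-Branching (t ∷ u ∷ ts))

    suppress*-Branching : ∀ ts → All Branching (suppress* ts)
    suppress*-Branching []       = []
    suppress*-Branching (t ∷ ts) = suppress-Branching t ∷ suppress*-Branching ts

  cherry : Tree
  cherry = node (leaf ∷ leaf ∷ [])

  Branching-1 : ∀ {t} → Branching t → leaves t ≡ 1 → t ≡ leaf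
  Branching-1 single _ = refl
  Branching-1 {node ts@(_ ∷ _)} (internal p _) e =
    contradiction (≤-trans p (≤-trans (length≤leaves* ts) (≤-reflexive e))) λ { (s≤s ()) }

  Branching-2 : ∀ {t} → Branching t → leaves t ≡ 2 → t ≡ cherry
  Branching-2 {node ts@(_ ∷ _ ∷ _ ∷ _)} (internal p _) e = contradiction (≤-trans (length≤leaves* ts)
      (≤-reflexive e)) λ { (s≤s (s≤s ())) }
  Branching-2 {node (t ∷ [])} (internal (s≤s ()) _) e
  Branching-2 {node (t ∷ u ∷ [])} (internal _ (b ∷ b′ ∷ [])) e =
    cong₂ (λ t u → node (t ∷ u ∷ [])) (Branching-1 b lt) (Branching-1 b′ lu)
    where
    e′ : leaves t + leaves u ≡ 2
    e′ = trans (cong (leaves t +_) (sym (+-identityʳ _))) e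
    lt : leaves t ≡ 1
    lt = ≤-antisym (≤-pred (≤-trans (≤-trans (≤-reflexive (+-comm 1 _)) (+-monoʳ-≤ (leaves t) (leaves>0 u)))
        (≤-reflexive e′))) (leaves>0 t)
    lu : leaves u ≡ 1
    lu = suc-injective (trans (cong (_+ leaves u) (sym lt)) e′)

  induced-Branching : ∀ t S → MaybeAll Branching (induced t S)
  induced-Branching t S rewrite induced-span t S with span t S
  ... | nothing = nothing
  ... | just u  = just (suppress-Branching u)

  -- If `D` is the only branching tree of its size, then every set of that size induces it. The
  -- uniqueness is asked among `Branching` trees, since the arity of `T` is arbitrary here.
  c≡C : ∀ D → (∀ {E} → MaybeAll Branching E → ‖ E ‖ ≡ ‖ D ‖ → E ≡ D) → ∀ T → c D T ≡ leaves T C ‖ D ‖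
  c≡C D unique T = trans (c≡Σ⊆ D T) (trans (Σ⊆-cong (leaves T) λ S →
    ⟦⟧-cong {P? = induced T S ≅∅? D} {∣ S ∣ ≟ ‖ D ‖} (mk⇔
      (λ e → trans (sym (‖induced‖ T S)) (≅∅⇒‖‖≡ e))
      (λ e → MP.reflexive (λ { refl → ≅-refl _ }) (unique (induced-Branching T S) (trans (‖induced‖ T S) e)))))
    (Σ⊆-C (leaves T) ‖ D ‖))

  c-nothing : ∀ T → c nothing T ≡ 1
  c-nothing T = c≡C nothing unique T
    where
    unique : ∀ {E} → MaybeAll Branching E → ‖ E ‖ ≡ 0 → E ≡ nothing
    unique nothing      _ = refl
    unique (just {t} _) e = contradiction (leaves>0 t) (λ p → n≮n 0 (≤-trans p (≤-reflexive e)))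

  c-leaf : ∀ T → c (just leaf) T ≡ leaves T
  c-leaf T = trans (c≡C (just leaf) unique T) (nC1≡n (leaves T))
    where
    unique : ∀ {E} → MaybeAll Branching E → ‖ E ‖ ≡ 1 → E ≡ just leaf
    unique (just b) e = cong just (Branching-1 b e)

  c-cherry : ∀ T → c (just cherry) T ≡ leaves T C 2
  c-cherry = c≡C (just cherry) unique
    where
    unique : ∀ {E} → MaybeAll Branching E → ‖ E ‖ ≡ 2 → E ≡ just cherry
    unique (just b) e = cong just (Branching-2 b e)

  mutual
    Dary⇒Branching : ∀ {d t} → Dary d t → Branching t
    Dary⇒Branching single             = single
    Dary⇒Branching (internal 2≤ _ ts) = internal 2≤ (Dary*⇒Branching* ts)

    Dary*⇒Branching* : ∀ {d ts} → All (Dary d) ts → All Branching ts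
    Dary*⇒Branching* []       = []
    Dary*⇒Branching* (t ∷ ts) = Dary⇒Branching t ∷ Dary*⇒Branching* ts

  -- Binomial coefficients and falling factorials

  nP′k≡0 : ∀ {n k} → n < k → n P′ k ≡ 0
  nP′k≡0 {n} {suc k} (s≤s n≤k) = cong (_* (n P′ k)) (m≤n⇒m∸n≡0 n≤k)

  -- For k > n both sides vanish, the right one because a truncated difference in `P′` is 0. The
  -- recursion of `P′` later gives the asymptotics of C(x, k) one factor at a time.
  nCk*k!≡nP′k : ∀ n k → (n C k) * k ! ≡ n P′ k
  nCk*k!≡nP′k n k with k ≤? n
  ... | no  k≰n = trans (cong (_* k !) (k>n⇒nCk≡0 (≰⇒> k≰n))) (sym (nP′k≡0 (≰⇒> k≰n)))
  ... | yes k≤n = trans (cong (_* k !) (trans (nCk≡nPk/k! k≤n) (cong (λ p → (p / k !) {{k !≢0}}) nPk≡nP′k)))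
    (m/n*n≡m {{k !≢0}} (k!∣nP′k k≤n))
    where
    nPk≡nP′k : n P k ≡ n P′ k
    nPk≡nP′k with k ≤ᵇ n in eq
    ... | true  = refl
    ... | false = contradiction (subst T eq (≤⇒≤ᵇ k≤n)) λ ()

  -- Lists of possibly empty trees up to isomorphism and rearrangement

  infix 4 _↭∅_ _≋∅_ _≋∅?_

  ≅∅-setoid : Setoid 0ℓ 0ℓ
  ≅∅-setoid = MP.setoid ≅-setoid

  _↭∅_ : Rel (List Tree∅) 0ℓ
  _↭∅_ = Permutation _≅∅_

  _≋∅_ : Rel (List Tree∅) 0ℓ
  _≋∅_ = Pointwise _≅∅_

  _≋∅?_ : Binary.Decidable _≋∅_
  _≋∅?_ = PW.decidable _≅∅?_

  private
    module P  = PermP ≅-setoid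
    module P∅ = PermP ≅∅-setoid
    module S∅ = Setoid ≅∅-setoid

  ≋∅-refl : ∀ {ws} → ws ≋∅ ws
  ≋∅-refl = PW.refl S∅.refl

  ↭∅-refl : ∀ {ws} → ws ↭∅ ws
  ↭∅-refl = Perm.refl ≋∅-refl

  ↭∅-sym : ∀ {ws ws′} → ws ↭∅ ws′ → ws′ ↭∅ ws
  ↭∅-sym = Perm.sym S∅.sym

  ↭-refl : ∀ {ts} → Permutation _≅_ ts ts
  ↭-refl = Perm.refl (≅-refl* _)

  -- Words of branches

  words : ∀ ts → Subset (leaves* ts) → List Tree∅
  words []       S = []
  words (t ∷ ts) S = induced t (takeᵛ (leaves t) S) ∷ words ts (dropᵛ (leaves t) S)

  length-words : ∀ ts S → length (words ts S) ≡ length ts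
  length-words []       S = refl
  length-words (t ∷ ts) S = cong suc (length-words ts _)

  suppress*-span* : ∀ ts S → suppress* (span* ts S) ≡ catMaybes (words ts S)
  suppress*-span* []       S = refl
  suppress*-span* (t ∷ ts) S rewrite induced-span t (takeᵛ (leaves t) S) with span t (takeᵛ (leaves t) S)
  ... | nothing = suppress*-span* ts _
  ... | just u  = cong (suppress u ∷_) (suppress*-span* ts _)

  -- What suppression makes of a root whose branches have already been treated: with no branch left
  -- the tree is empty, and a single branch absorbs the root.
  join : List Tree → Tree∅
  join []                = nothing
  join (t ∷ [])          = just t
  join ts@(_ ∷ _ ∷ _)    = just (node ts)

  induced-node : ∀ t ts S → induced (node (t ∷ ts)) S ≡ join (catMaybes (words (t ∷ ts) S))
  induced-node t ts S = trans (induced-span (node (t ∷ ts)) S) (trans lem (cong join (suppress*-span* (t ∷ ts) S)))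
    where
    lem : Maybe.map suppress (span (node (t ∷ ts)) S) ≡ join (suppress* (span* (t ∷ ts) S))
    lem with span* (t ∷ ts) S
    ... | []        = refl
    ... | _ ∷ []    = refl
    ... | _ ∷ _ ∷ _ = refl

  -- The source of the two sums in the recursion: either the root of `D` sits at the root and the
  -- letters are its branches, or a single branch contains the whole copy of `D`. The lengths, at
  -- least 2 and exactly 1, exclude each other.
  ⟦join≅⟧ : ∀ {ds} → 2 ≤ length ds → ∀ us →
            ⟦ join us ≅∅? just (node ds) ⟧ ≡ ⟦ us ↭? ds ⟧ + ⟦ us ↭? (node ds ∷ []) ⟧
  ⟦join≅⟧ {ds} 2≤ us = ⟦⟧-+ {P? = join us ≅∅? just (node ds)} {us ↭? ds} {us ↭? (node ds ∷ [])}
    (mk⇔ (split us) (unsplit us))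
    (λ (p , q) → <-irrefl (trans (sym (P.xs↭ys⇒|xs|≡|ys| q)) (P.xs↭ys⇒|xs|≡|ys| p)) 2≤)
    where
    split : ∀ us → join us ≅∅ just (node ds) → Permutation _≅_ us ds ⊎ Permutation _≅_ us (node ds ∷ [])
    split (_ ∷ [])    (just e)         = inj₂ (Perm.prep e ↭-refl)
    split (_ ∷ _ ∷ _) (just (node≅ p)) = inj₁ p
    unsplit : ∀ us → Permutation _≅_ us ds ⊎ Permutation _≅_ us (node ds ∷ []) → join us ≅∅ just (node ds)
    unsplit []          (inj₁ p) = contradiction (subst (2 ≤_) (sym (P.xs↭ys⇒|xs|≡|ys| p)) 2≤) λ ()
    unsplit (_ ∷ [])    (inj₁ p) = contradiction (subst (2 ≤_) (sym (P.xs↭ys⇒|xs|≡|ys| p)) 2≤) λ { (s≤s ()) }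
    unsplit (_ ∷ _ ∷ _) (inj₁ p) = just (node≅ p)
    unsplit []          (inj₂ p) = contradiction (P.xs↭ys⇒|xs|≡|ys| p) λ ()
    unsplit (t ∷ [])    (inj₂ p) with P.∈-resp-↭ p (here (≅-refl t))
    ... | here e = just e
    unsplit (_ ∷ _ ∷ _) (inj₂ p) = contradiction (P.xs↭ys⇒|xs|≡|ys| p) λ ()

  c-node : ∀ {ds} → 2 ≤ length ds → ∀ t ts → let n = leaves* (t ∷ ts) in
           c (just (node ds)) (node (t ∷ ts)) ≡
           Σ⊆ n (λ S → ⟦ catMaybes (words (t ∷ ts) S) ↭? ds ⟧) +
           Σ⊆ n (λ S → ⟦ catMaybes (words (t ∷ ts) S) ↭? (node ds ∷ []) ⟧)
  c-node {ds} 2≤ t ts = trans (c≡Σ⊆ (just (node ds)) (node (t ∷ ts))) (trans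
    (Σ⊆-cong (leaves* (t ∷ ts)) λ S → trans
      (cong (λ U → ⟦ U ≅∅? just (node ds) ⟧) (induced-node t ts S))
      (⟦join≅⟧ 2≤ (catMaybes (words (t ∷ ts) S))))
    (Σ⊆-+ (leaves* (t ∷ ts)) _ _))

  ⟦catMaybes↭[]⟧ : ∀ w ws → ⟦ catMaybes (w ∷ ws) ↭? [] ⟧ ≡ ⟦ w ≅∅? nothing ⟧ * ⟦ catMaybes ws ↭? [] ⟧
  ⟦catMaybes↭[]⟧ nothing  ws = sym (+-identityʳ _)
  ⟦catMaybes↭[]⟧ (just t) ws = ⟦⟧-no {P? = (t ∷ catMaybes ws) ↭? []} P.¬x∷xs↭[]

  -- The only nonempty letter is either the first one or a later one.
  ⟦catMaybes↭[t]⟧ : ∀ t w ws → ⟦ catMaybes (w ∷ ws) ↭? (t ∷ []) ⟧ ≡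
                    ⟦ w ≅∅? just t ⟧ * ⟦ catMaybes ws ↭? [] ⟧ + ⟦ w ≅∅? nothing ⟧ * ⟦ catMaybes ws ↭? (t ∷ []) ⟧
  ⟦catMaybes↭[t]⟧ t nothing  ws = sym (+-identityʳ _)
  ⟦catMaybes↭[t]⟧ t (just u) ws = trans
    (⟦⟧-* {P? = (u ∷ catMaybes ws) ↭? (t ∷ [])} {just u ≅∅? just t} {catMaybes ws ↭? []}
      (mk⇔ split λ { (just e , p) → Perm.prep e p }))
    (sym (+-identityʳ _))
    where
    split : Permutation _≅_ (u ∷ catMaybes ws) (t ∷ []) → (just u ≅∅ just t) × Permutation _≅_ (catMaybes ws) []
    split p with P.∈-resp-↭ p (here (≅-refl u))
    ... | here e = just e , P.drop-∷ (Perm.trans p (Perm.prep (≅-sym e) ↭-refl))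

  Σ⊆-none : ∀ ts → Σ⊆ (leaves* ts) (λ S → ⟦ catMaybes (words ts S) ↭? [] ⟧) ≡ 1
  Σ⊆-none []       = refl
  Σ⊆-none (t ∷ ts) = trans (Σ⊆-cong (leaves* (t ∷ ts)) (λ S → ⟦catMaybes↭[]⟧ (induced t (takeᵛ (leaves t) S)) (words ts
      (dropᵛ (leaves t) S)))) (trans
    (Σ⊆-* (leaves t) (leaves* ts) (λ S → ⟦ induced t S ≅∅? nothing ⟧) _)
    (cong₂ _*_ (trans (sym (c≡Σ⊆ nothing t)) (c-nothing t)) (Σ⊆-none ts)))

  -- Only the empty set induces the empty tree, so every branch other than the one that receives `D`
  -- contributes the factor 1.
  Σ⊆-one : ∀ D {k} (t : Vector Tree k) →
           Σ⊆ (leaves* (tabulate t)) (λ S → ⟦ catMaybes (words (tabulate t) S) ↭? (D ∷ []) ⟧) ≡ foldr _+_ 0 (λ j → c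
               (just D) (t j))
  Σ⊆-one D {zero}  t = ⟦⟧-no {P? = [] ↭? (D ∷ [])} (P.¬x∷xs↭[] ∘ ↭-sym)
  Σ⊆-one D {suc k} t = trans
    (Σ⊆-cong (leaves* (tabulate t)) (λ S → ⟦catMaybes↭[t]⟧ D (induced t₀ (takeᵛ (leaves t₀) S)) (words ts (dropᵛ
        (leaves t₀) S)))) (trans
    (Σ⊆-+ (leaves* (tabulate t)) _ _) (cong₂ _+_
      (trans (Σ⊆-* (leaves t₀) (leaves* ts) (λ S → ⟦ induced t₀ S ≅∅? just D ⟧) _) (trans
        (cong₂ _*_ (sym (c≡Σ⊆ (just D) t₀)) (Σ⊆-none ts)) (*-identityʳ _)))
      (trans (Σ⊆-* (leaves t₀) (leaves* ts) (λ S → ⟦ induced t₀ S ≅∅? nothing ⟧) _) (trans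
        (cong₂ _*_ (trans (sym (c≡Σ⊆ nothing t₀)) (c-nothing t₀)) (Σ⊆-one D (t ∘ suc))) (*-identityˡ _)))))
    where
    t₀ = t zero
    ts = tabulate (t ∘ suc)

  Σ⊆-words : ∀ {k} (w : Vector Tree∅ k) (t : Vector Tree k) →
             Σ⊆ (leaves* (tabulate t)) (λ S → ⟦ words (tabulate t) S ≋∅? tabulate w ⟧) ≡ foldr _*_ 1 (λ j → c (w j) (t j))
  Σ⊆-words {zero}  w t = refl
  Σ⊆-words {suc k} w t = trans
    (Σ⊆-cong (leaves* (tabulate t)) λ S →
      ⟦⟧-* {P? = words (tabulate t) S ≋∅? tabulate w}
           {induced t₀ (takeᵛ (leaves t₀) S) ≅∅? w zero} {words ts (dropᵛ (leaves t₀) S) ≋∅? tabulate (w ∘ suc)}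
           (mk⇔ (λ { (e ∷ es) → e , es }) (λ (e , es) → e ∷ es))) (trans
    (Σ⊆-* (leaves t₀) (leaves* ts) (λ S → ⟦ induced t₀ S ≅∅? w zero ⟧) _)
    (cong₂ _*_ (sym (c≡Σ⊆ (w zero) t₀)) (Σ⊆-words (w ∘ suc) (t ∘ suc))))
    where
    t₀ = t zero
    ts = tabulate (t ∘ suc)

  -- Words with given letters and permutations

  catMaybes-≋ : ∀ {ws ws′} → ws ≋∅ ws′ → Pointwise _≅_ (catMaybes ws) (catMaybes ws′)
  catMaybes-≋ []             = []
  catMaybes-≋ (just e ∷ es)  = e ∷ catMaybes-≋ es
  catMaybes-≋ (nothing ∷ es) = catMaybes-≋ es

  catMaybes-↭ : ∀ {ws ws′} → ws ↭∅ ws′ → Permutation _≅_ (catMaybes ws) (catMaybes ws′)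
  catMaybes-↭ (Perm.refl es)                     = Perm.refl (catMaybes-≋ es)
  catMaybes-↭ (Perm.prep (just e) p)             = Perm.prep e (catMaybes-↭ p)
  catMaybes-↭ (Perm.prep nothing p)              = catMaybes-↭ p
  catMaybes-↭ (Perm.swap (just e) (just f) p)    = Perm.swap e f (catMaybes-↭ p)
  catMaybes-↭ (Perm.swap (just e) nothing p)     = Perm.prep e (catMaybes-↭ p)
  catMaybes-↭ (Perm.swap nothing (just f) p)     = Perm.prep f (catMaybes-↭ p)
  catMaybes-↭ (Perm.swap nothing nothing p)      = catMaybes-↭ p
  catMaybes-↭ (Perm.trans p q)                   = Perm.trans (catMaybes-↭ p) (catMaybes-↭ q)

  ↭∅-pad : ∀ ws → ∃[ m ] length (catMaybes ws) + m ≡ length ws × ws ↭∅ map just (catMaybes ws) ++ replicate m nothing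
  ↭∅-pad []             = 0 , refl , ↭∅-refl
  ↭∅-pad (just t ∷ ws)  with m , e , p ← ↭∅-pad ws = m , cong suc e , Perm.prep S∅.refl p
  ↭∅-pad (nothing ∷ ws) with m , e , p ← ↭∅-pad ws =
    suc m , trans (+-suc _ m) (cong suc e) ,
    Perm.trans (Perm.prep S∅.refl p) (↭∅-sym (P∅.↭-shift (map just (catMaybes ws)) _))

  -- Both words are brought to the normal form of `↭∅-pad`, nonempty letters followed by padding;
  -- equal lengths force equal padding.
  catMaybes-↭⁻ : ∀ {ws ws′} → length ws ≡ length ws′ →
                 Permutation _≅_ (catMaybes ws) (catMaybes ws′) → ws ↭∅ ws′
  catMaybes-↭⁻ {ws} {ws′} l p with m , e , q ← ↭∅-pad ws | m′ , e′ , q′ ← ↭∅-pad ws′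
    with refl ← +-cancelˡ-≡ (length (catMaybes ws)) m m′
      (trans e (trans l (trans (sym e′) (cong (_+ m′) (sym (P.xs↭ys⇒|xs|≡|ys| p)))))) =
    Perm.trans q (Perm.trans (P∅.++⁺ʳ _ (P.map⁺ ≅∅-setoid just p)) (↭∅-sym q′))

  tabulate-punchIn : ∀ {k} (B : Vector Tree∅ (suc k)) i → B i ∷ tabulate (B ∘ punchIn i) ↭∅ tabulate B
  tabulate-punchIn         B zero    = ↭∅-refl
  tabulate-punchIn {suc k} B (suc i) =
    Perm.trans (Perm.swap S∅.refl S∅.refl ↭∅-refl) (Perm.prep S∅.refl (tabulate-punchIn (B ∘ suc) i))

  tabulate-permute : ∀ {k} (B : Vector Tree∅ k) (π : Permutation′ k) → tabulate (B ∘ (π ⟨$⟩ʳ_)) ↭∅ tabulate B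
  tabulate-permute {zero}  B π = ↭∅-refl
  tabulate-permute {suc k} B π = Perm.trans
    (Perm.prep S∅.refl (Perm.trans
      (Perm.refl (PW.tabulate⁺ λ j → S∅.reflexive (cong B (punchIn-permute π zero j))))
      (tabulate-permute (B ∘ punchIn (π ⟨$⟩ʳ zero)) (remove zero π))))
    (tabulate-punchIn B (π ⟨$⟩ʳ zero))

  -- The permutation is built letter by letter: the first letter is matched with some position `i`
  -- of `B`, and the rest with the remaining positions, enumerated by `punchIn i`.
  ↭∅-tabulate⁻ : ∀ {k} ws (B : Vector Tree∅ k) → ws ↭∅ tabulate B →
                 Σ[ π ∈ Permutation′ k ] ws ≋∅ tabulate (B ∘ (π ⟨$⟩ʳ_))
  ↭∅-tabulate⁻ {zero}  []       B p = idₚ , []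
  ↭∅-tabulate⁻ {zero}  (_ ∷ _)  B p = contradiction p P∅.¬x∷xs↭[]
  ↭∅-tabulate⁻ {suc k} []       B p = contradiction (↭∅-sym p) P∅.¬x∷xs↭[]
  ↭∅-tabulate⁻ {suc k} (w ∷ ws) B p
    with i , e ← AnyP.tabulate⁻ (P∅.∈-resp-↭ p (here S∅.refl))
    with ρ , es ← ↭∅-tabulate⁻ ws (B ∘ punchIn i)
      (P∅.drop-∷ (Perm.trans (Perm.prep (S∅.sym e) ↭∅-refl) (Perm.trans p (↭∅-sym (tabulate-punchIn B i)))))
    = insert zero i ρ , e ∷ es

  catMaybes-branches : ∀ {k} ds → length ds ≤ k → catMaybes (tabulate (branches k (node ds))) ≡ ds
  catMaybes-branches {zero}  []       _       = refl
  catMaybes-branches {suc k} []       _       = trans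
    (cong catMaybes (tabulate-cong {n = k} (λ i → cong head (sym (drop-[] (toℕ i)))))) (catMaybes-branches {k} [] z≤n)
  catMaybes-branches {suc k} (t ∷ ds) (s≤s p) = cong (t ∷_) (catMaybes-branches ds p)

  module _ {k : ℕ} {ds : List Tree} (len : length ds ≤ k)
           {M : List (Permutation′ k)} (complete : IsCompleteSetOfRepresentatives (branches k (node ds)) M) where

    private B = branches k (node ds)

    -- A rearrangement of the padded branches is given by some permutation, and its representative
    -- in `M` spells the same word up to isomorphism.
    letters⇔word : ∀ {ws} → length ws ≡ k →
                   Permutation _≅_ (catMaybes ws) ds ⇔ Any (λ π → ws ≋∅ tabulate (B ∘ (π ⟨$⟩ʳ_))) M
    letters⇔word {ws} l = mk⇔ split unsplit
      where
      split : Permutation _≅_ (catMaybes ws) ds → Any (λ π → ws ≋∅ tabulate (B ∘ (π ⟨$⟩ʳ_))) M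
      split p with π , e ← ↭∅-tabulate⁻ ws B (catMaybes-↭⁻ (trans l (sym (length-tabulate B)))
                             (subst (Permutation _≅_ (catMaybes ws)) (sym (catMaybes-branches ds len)) p)) =
        Any.map (λ π∼ρ → PW.transitive S∅.trans e (PW.tabulate⁺ π∼ρ)) (proj₂ complete π)
      unsplit : Any (λ π → ws ≋∅ tabulate (B ∘ (π ⟨$⟩ʳ_))) M → Permutation _≅_ (catMaybes ws) ds
      unsplit a with π , e ← Any.satisfied a =
        subst (Permutation _≅_ (catMaybes ws)) (catMaybes-branches ds len)
          (catMaybes-↭ (Perm.trans (Perm.refl e) (tabulate-permute B π)))

    -- Two representatives that spell the same word would be equivalent under the relation that
    -- defines M(D).
    words-distinct : ∀ ws → AllPairs (λ π ρ → ¬ (ws ≋∅ tabulate (B ∘ (π ⟨$⟩ʳ_)) × ws ≋∅ tabulate (B ∘ (ρ ⟨$⟩ʳ_)))) M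
    words-distinct ws = AllPairs.map
      (λ π≁ρ (e , f) → π≁ρ (PW.tabulate⁻ (PW.transitive S∅.trans (PW.symmetric S∅.sym e) f))) (proj₁ complete)

    Σ⊆-letters : (t : Vector Tree k) →
      Σ⊆ (leaves* (tabulate t)) (λ S → ⟦ catMaybes (words (tabulate t) S) ↭? ds ⟧) ≡
      sum (map (λ π → foldr _*_ 1 (λ j → c (B (π ⟨$⟩ʳ j)) (t j))) M)
    Σ⊆-letters t = trans (Σ⊆-cong n (λ S → let ws = words (tabulate t) S in
        ⟦⟧-Any {P? = catMaybes ws ↭? ds} (λ π → ws ≋∅? tabulate (B ∘ (π ⟨$⟩ʳ_))) M
          (letters⇔word (trans (length-words (tabulate t) S) (length-tabulate t))) (words-distinct ws)))
      (trans (Σ⊆-sum n (λ π S → ⟦ words (tabulate t) S ≋∅? tabulate (B ∘ (π ⟨$⟩ʳ_)) ⟧) M)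
      (cong sum (map-cong (λ π → Σ⊆-words (B ∘ (π ⟨$⟩ʳ_)) t) M)))
      where
      n = leaves* (tabulate t)

  -- The number `k` is both the length of the padded list of branches of D and the number of root
  -- branches of the other tree, so that a permutation assigns a possibly empty branch of D to each
  -- of them.
  c-recursion : ∀ {k ds} → 2 ≤ length ds → (len : length ds ≤ k) →
    ∀ {M} → IsCompleteSetOfRepresentatives (branches k (node ds)) M → (t : Vector Tree k) →
    c (just (node ds)) (node (tabulate t)) ≡
    sum (map (λ π → foldr _*_ 1 (λ j → c (branches k (node ds) (π ⟨$⟩ʳ j)) (t j))) M) +
    foldr _+_ 0 (λ j → c (just (node ds)) (t j))
  c-recursion {zero}  2≤ len comp t = contradiction (≤-trans 2≤ len) λ ()
  c-recursion {suc k} {ds} 2≤ len comp t = trans (c-node 2≤ (t zero) (tabulate (t ∘ suc)))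
    (cong₂ _+_ (Σ⊆-letters len comp t) (Σ⊆-one (node ds) t))

  -- Unique enumerations

  module _ {a ℓ} (S : Setoid a ℓ) where
    private module S = Setoid S
    open S using (_≈_)
    open Membership S using (_∈_; _─_)
    open Unique S using (Unique)

    ∈-─ : ∀ {x y ys} (p : x ∈ ys) → y ∈ ys → ¬ (x ≈ y) → y ∈ (ys ─ p)
    ∈-─ (here e)  (here f)  x≉y = contradiction (S.trans e (S.sym f)) x≉y
    ∈-─ (here e)  (there q) x≉y = q
    ∈-─ (there p) (here f)  x≉y = here f
    ∈-─ (there p) (there q) x≉y = there (∈-─ p q x≉y)

    length-─ : ∀ {x ys} (p : x ∈ ys) → suc (length (ys ─ p)) ≡ length ys
    length-─ (here _)  = refl
    length-─ (there p) = cong suc (length-─ p)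

    -- Pigeonhole principle: after one copy of `x` is deleted from `ys`, the other elements of `xs`
    -- are still there, being different from `x`.
    Unique⇒length≤ : ∀ {xs ys} → Unique xs → (∀ {z} → z ∈ xs → z ∈ ys) → length xs ≤ length ys
    Unique⇒length≤ []       xs⊆ys = z≤n
    Unique⇒length≤ {x ∷ xs} {ys} (x∉xs ∷ u) xs⊆ys = ≤-trans
      (s≤s (Unique⇒length≤ u λ {z} z∈xs → ∈-─ x∈ys (xs⊆ys (there z∈xs))
        (All.lookupWith (λ x≉w z≈w x≈z → x≉w (S.trans x≈z z≈w)) x∉xs z∈xs)))
      (≤-reflexive (length-─ x∈ys))
      where x∈ys = xs⊆ys (here S.refl)

  -- Makes |M(D)| well defined: the limit is built from one computed list, while the theorem speaks
  -- of an arbitrary complete set of representatives.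
  length-representatives : ∀ {d} (B : Vector Tree∅ d) {M N} →
    IsCompleteSetOfRepresentatives B M → IsCompleteSetOfRepresentatives B N → length M ≡ length N
  length-representatives B (uM , cM) (uN , cN) = ≤-antisym
    (Unique⇒length≤ (∼-setoid B) uM λ {z} _ → cN z)
    (Unique⇒length≤ (∼-setoid B) uN λ {z} _ → cM z)

  -- Numbers of leaves of the strictly d-ary trees and their branches

  leaves*-replicate : ∀ a t → leaves* (replicate a t) ≡ a * leaves t
  leaves*-replicate zero    t = refl
  leaves*-replicate (suc a) t = cong (leaves t +_) (leaves*-replicate a t)

  leaves*-tabulate : ∀ {k} (t : Vector Tree k) → leaves* (tabulate t) ≡ foldr _+_ 0 (leaves ∘ t)
  leaves*-tabulate {zero}  t = refl
  leaves*-tabulate {suc k} t = cong (leaves (t zero) +_) (leaves*-tabulate (t ∘ suc))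

  leaves-node* : ∀ {ts} → 1 ≤ length ts → leaves (node ts) ≡ leaves* ts
  leaves-node* {_ ∷ _} _ = refl

  replicate-tabulate : ∀ {A B : Set} (f : A → B) p q {k} a b → a + b ≡ k →
    replicate a (f p) ++ replicate b (f q) ≡ tabulate {n = k} (λ j → f (if toℕ j <ᵇ a then p else q))
  replicate-tabulate f p q zero    zero    refl = refl
  replicate-tabulate f p q zero    (suc b) refl = cong (f q ∷_) (replicate-tabulate f p q zero b refl)
  replicate-tabulate f p q (suc a) b       refl = cong (f p ∷_) (replicate-tabulate f p q a b refl)

  module _ (d : ℕ) .{{_ : NonTrivial d}} where

    private
      instance
        d≢0 : NonZero d
        d≢0 = nonTrivial⇒nonZero d
      e = pred d
      suc-e : suc e ≡ d
      suc-e = suc-pred d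

    x : ℕ → ℕ
    x n = leaves (H d n)

    child : ℕ → Fin d → ℕ
    child m j = if toℕ j <ᵇ d ∸ m % d then m / d else suc (m / d)

    private
      H-suc′ : ∀ m → H d (suc m) ≡ node (replicate (d ∸ m % d) (H d (m / d)) ++ replicate (m % d) (H d (suc (m / d))))
      H-suc′ m = trans (cong (H d ∘ suc) (trans (m≡m%n+[m/n]*n m d) (trans (+-comm (m % d) _) (cong (_+ m % d) (*-comm
          (m / d) d)))))
        (H-suc d (m / d) (m % d) (m%n<n m d))

      m/d<m : ∀ m {b} → m % d ≡ suc b → m / d < m
      m/d<m zero    eq = contradiction (trans (sym eq) (m<n⇒m%n≡m (>-nonZero⁻¹ d))) λ ()
      m/d<m (suc m) _  = m/n<m (suc m) d (nonTrivial⇒n>1 d)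

    H-children : ∀ m → H d (suc m) ≡ node (tabulate (λ j → H d (child m j)))
    H-children m = trans (H-suc′ m)
      (cong node (replicate-tabulate (H d) (m / d) (suc (m / d)) (d ∸ m % d) (m % d) (m∸n+n≡m (<⇒≤ (m%n<n m d)))))

    x≡ : ∀ n → x n ≡ pred d * n + 1
    x≡ n = go n n ≤-refl
      where
      go : ∀ f n → n ≤ f → x n ≡ e * n + 1
      go f       zero    _         = cong (_+ 1) (sym (*-zeroʳ e))
      go (suc f) (suc m) (s≤s m≤f) = begin
        leaves (H d (suc m))                            ≡⟨ cong leaves (H-suc′ m) ⟩
        leaves (node (xs ++ ys))                        ≡⟨ leaves-node* {xs ++ ys} (≤-trans (>-nonZero⁻¹ d) (≤-reflexive
            (sym len))) ⟩
        leaves* (xs ++ ys)                              ≡⟨ leaves*-++ xs ys ⟩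
        leaves* xs + leaves* ys                         ≡⟨ cong₂ _+_ (leaves*-replicate (d ∸ b) _) (leaves*-replicate b _) ⟩
        (d ∸ b) * x s + b * x (suc s)                   ≡⟨ cong₂ _+_ (cong ((d ∸ b) *_) (go f s (≤-trans
            (m/n≤m m d) m≤f))) (second b refl) ⟩
        (d ∸ b) * (e * s + 1) + b * (e * suc s + 1)     ≡⟨ solve 4 (λ a b e s → a :* (e :* s :+ con 1) :+ b :* (e :*
            (con 1 :+ s) :+ con 1) := (a :+ b) :* (e :* s :+ con 1) :+ b :* e) refl (d ∸ b) b e s ⟩
        (d ∸ b + b) * (e * s + 1) + b * e               ≡⟨ cong (λ k → k * (e * s + 1) + b * e) (trans (m∸n+n≡m (<⇒≤
            (m%n<n m d))) (sym suc-e)) ⟩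
        suc e * (e * s + 1) + b * e                     ≡⟨ solve 3 (λ e s b → (con 1 :+ e) :*
            (e :* s :+ con 1) :+ b :* e := e :* (con 1 :+ (b :+ s :* (con 1 :+ e))) :+ con 1) refl e s b ⟩
        e * suc (b + s * suc e) + 1                     ≡⟨ cong (λ k → e * suc k + 1) (trans (cong
            (λ k → b + s * k) suc-e) (sym (m≡m%n+[m/n]*n m d))) ⟩
        e * suc m + 1                                   ∎
        where
        open ≡-Reasoning
        open +-*-Solver
        s  = m / d
        b  = m % d
        xs = replicate (d ∸ b) (H d s)
        ys = replicate b (H d (suc s))
        len : length (xs ++ ys) ≡ d
        len = trans (length-++ xs) (trans (cong₂ _+_ (length-replicate (d ∸ b)) (length-replicate b)) (m∸n+n≡m (<⇒≤ (m%n<n m d))))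
        second : ∀ k → m % d ≡ k → k * x (suc s) ≡ k * (e * suc s + 1)
        second zero    _  = refl
        second (suc k) eq = cong (suc k *_) (go f (suc s) (≤-trans (m/d<m m eq) m≤f))

    x>0 : ∀ n → 0 < x n
    x>0 n = leaves>0 (H d n)

    n≤x : ∀ n → n ≤ x n
    n≤x n = ≤-trans (≤-trans (≤-reflexive (sym (*-identityˡ n))) (*-monoˡ-≤ n (≤-pred (subst (2 ≤_) (sym suc-e)
        (nonTrivial⇒n>1 d)))))
      (≤-trans (m≤m+n _ 1) (≤-reflexive (sym (x≡ n))))

    private
      -- The common source of the size estimates: `z` is the size of a smaller branch, and `b` of
      -- the d branches have d - 1 further leaves each. If branch j is a larger one, then there is
      -- one, so `b` is positive.
      child-size : ∀ m j → ∃[ z ] ∃[ b ] 1 ≤ z × b ≤ d × x (suc m) ≡ d * z + b * e ×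
                   (x (child m j) ≡ z ⊎ x (child m j) ≡ z + e × 1 ≤ b)
      child-size m j = e * s + 1 , b , m≤n+m 1 _ , <⇒≤ (m%n<n m d) , size , kind
        where
        s = m / d
        b = m % d
        size : x (suc m) ≡ d * (e * s + 1) + b * e
        size = trans (x≡ (suc m)) (trans (cong (λ k → e * suc k + 1) (trans (m≡m%n+[m/n]*n m d) (cong (λ k → b + s * k)
            (sym suc-e))))
          (trans (solve 3 (λ e s b → e :* (con 1 :+ (b :+ s :* (con 1 :+ e))) :+ con 1 := (con 1 :+ e) :*
              (e :* s :+ con 1) :+ b :* e) refl e s b)
          (cong (λ k → k * (e * s + 1) + b * e) suc-e)))
          where open +-*-Solver
        kind : x (child m j) ≡ e * s + 1 ⊎ x (child m j) ≡ e * s + 1 + e × 1 ≤ b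
        kind with toℕ j <ᵇ d ∸ b in eq
        ... | true  = inj₁ (x≡ s)
        ... | false = inj₂ (trans (x≡ (suc s)) (solve 2 (λ e s → e :*
            (con 1 :+ s) :+ con 1 := e :* s :+ con 1 :+ e) refl e s) , b>0 b refl)
          where
          open +-*-Solver
          b>0 : ∀ k → b ≡ k → 1 ≤ k
          b>0 zero    b≡0 = contradiction (trans (sym eq) (cong (toℕ j <ᵇ_) (cong (d ∸_) b≡0))) λ e → subst T (sym e)
              (<⇒<ᵇ (toℕ<n j))
          b>0 (suc k) _   = s≤s z≤n

    d*child≤ : ∀ m j → d * x (child m j) ≤ x (suc m) + d * d
    d*child≤ m j with z , b , 1≤z , b≤d , N≡ , k ← child-size m j rewrite N≡ with k
    ... | inj₁ y≡       rewrite y≡ = ≤-trans (m≤m+n (d * z) (b * e)) (m≤m+n _ _)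
    ... | inj₂ (y≡ , _) rewrite y≡ = ≤-trans (≤-reflexive (*-distribˡ-+ d z e))
      (+-mono-≤ (m≤m+n (d * z) (b * e)) (*-monoʳ-≤ d (pred[n]≤n {d})))

    private
      z≤child : ∀ {z y b} → (y ≡ z ⊎ y ≡ z + e × 1 ≤ b) → z ≤ y
      z≤child (inj₁ refl)       = ≤-refl
      z≤child (inj₂ (refl , _)) = m≤m+n _ e

    ≤d*child : ∀ m j → x (suc m) ≤ d * x (child m j) + d * d
    ≤d*child m j with z , b , 1≤z , b≤d , N≡ , k ← child-size m j = ≤-trans (≤-reflexive N≡)
      (+-mono-≤ (*-monoʳ-≤ d (z≤child k)) (*-mono-≤ b≤d (pred[n]≤n {d})))

    -- Bounds 1/x at a branch by d² times 1/x at the tree, so that a rate known at the branches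
    -- carries over to the tree.
    ≤d²*child : ∀ m j → x (suc m) ≤ d * d * x (child m j)
    ≤d²*child m j with z , b , 1≤z , b≤d , N≡ , k ← child-size m j = begin
      x (suc m)                ≡⟨ N≡ ⟩
      d * z + b * e            ≤⟨ +-monoʳ-≤ (d * z) (*-mono-≤ b≤d (m≤m*n e z {{>-nonZero 1≤z}})) ⟩
      d * z + d * (e * z)      ≡⟨ *-distribˡ-+ d z (e * z) ⟨
      d * (suc e * z)          ≡⟨ cong (λ k → d * (k * z)) suc-e ⟩
      d * (d * z)              ≡⟨ *-assoc d d z ⟨
      d * d * z                ≤⟨ *-monoʳ-≤ (d * d) (z≤child k) ⟩
      d * d * x (child m j)    ∎
      where open ≤-Reasoning

    -- The ratio 2/3 is attained for d = 2 and n = 2, where 3 leaves split into 1 and 2. For a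
    -- larger branch, of size z + e, it comes down to z ≤ e z, e ≤ e z and e ≤ b e.
    3*child≤ : ∀ m j → 3 * x (child m j) ≤ 2 * x (suc m)
    3*child≤ m j with z , b , 1≤z , b≤d , N≡ , k ← child-size m j rewrite N≡ with k
    ... | inj₁ y≡ rewrite y≡ = ≤-trans (*-monoˡ-≤ z {3} {4} (s≤s (s≤s (s≤s z≤n)))) (≤-trans (≤-reflexive (*-assoc 2 2 z))
      (*-monoʳ-≤ 2 (≤-trans (*-monoˡ-≤ z (nonTrivial⇒n>1 d)) (m≤m+n _ _))))
    ... | inj₂ (y≡ , 1≤b) rewrite y≡ = begin
      3 * (z + e)                                   ≡⟨ solve 2 (λ z e → con 3 :* (z :+ e) := (con 2 :* z :+
          (z :+ e)) :+ con 2 :* e) refl z e ⟩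
      (2 * z + (z + e)) + 2 * e                     ≤⟨ +-mono-≤ (+-monoʳ-≤ (2 * z) (+-mono-≤ z≤ez (m≤m*n e z {{>-nonZero 1≤z}})))
                                                        (*-monoʳ-≤ 2 (m≤n*m e b {{>-nonZero 1≤b}})) ⟩
      (2 * z + (e * z + e * z)) + 2 * (b * e)       ≡⟨ solve 3 (λ z e b → (con 2 :* z :+ (e :* z :+ e :* z)) :+ con 2 :*
          (b :* e) := con 2 :* ((con 1 :+ e) :* z :+ b :* e)) refl z e b ⟩
      2 * (suc e * z + b * e)                       ≡⟨ cong (λ k → 2 * (k * z + b * e)) suc-e ⟩
      2 * (d * z + b * e)                           ∎
      where
      open ≤-Reasoning
      open +-*-Solver
      z≤ez : z ≤ e * z
      z≤ez = m≤n*m z e {{>-nonZero (≤-pred (subst (2 ≤_) (sym suc-e) (nonTrivial⇒n>1 d)))}}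

    x-children : ∀ m → x (suc m) ≡ foldr _+_ 0 (λ j → x (child m j))
    x-children m = trans (cong leaves (H-children m)) (trans
      (leaves-node* {tabulate t} (≤-trans (>-nonZero⁻¹ d) (≤-reflexive (sym (length-tabulate t)))))
      (leaves*-tabulate t))
      where
      t = λ j → H d (child m j)

-- Asymptotics over the rationals

module Limit where

  open Counting
  import Data.Integer as ℤ
  import Data.Integer.Properties as ℤP
  import Data.List as L
  open import Data.Nat as ℕ using (ℕ; zero; suc; NonTrivial; NonZero; z≤n; s≤s; _!)
  open import Data.Nat.Combinatorics.Base using (_P′_)
  import Data.Nat.Properties as ℕP
  open import Data.Rational hiding (_÷_; NonZero)
  open import Data.Rational.Properties
  open import Data.Rational.Solver using (module +-*-Solver)
  import Data.Rational.Unnormalised as ℚᵘ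
  import Data.Rational.Unnormalised.Properties as ℚᵘP
  open import Algebra.Properties.CommutativeSemiring.Exp (CommutativeRing.commutativeSemiring +-*-commutativeRing)
    using (_^_; ^-homo-*; ^-distrib-*)
  open import Algebra.Properties.Semiring.Sum (CommutativeRing.semiring +-*-commutativeRing)
    using (∑-distrib-+; *-distribˡ-sum; *-distribʳ-sum; sum-cong-≗)
  import Algebra.Properties.CommutativeMonoid.Sum *-1-commutativeMonoid as Prod
  open +-*-Solver using (solve; _:+_; _:*_; _:-_; :-_; _:=_; con)

  -- Natural numbers as rationals

  ι : ℕ → ℚ
  ι n = n ÷ 1

  toℚᵘ-÷ : ∀ m n → toℚᵘ (m ÷ suc n) ℚᵘ.≃ ℚᵘ.mkℚᵘ (ℤ.+ m) n
  toℚᵘ-÷ m n = toℚᵘ-fromℚᵘ (ℚᵘ.mkℚᵘ (ℤ.+ m) n)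

  ι-+ : ∀ m n → ι (m ℕ.+ n) ≡ ι m + ι n
  ι-+ m n = toℚᵘ-injective (ℚᵘP.≃-trans (toℚᵘ-÷ (m ℕ.+ n) 0) (ℚᵘP.≃-sym (ℚᵘP.≃-trans (toℚᵘ-homo-+ (ι m) (ι n))
    (ℚᵘP.≃-trans (ℚᵘP.+-cong (toℚᵘ-÷ m 0) (toℚᵘ-÷ n 0)) (ℚᵘ.*≡* (cong (ℤ._* ℤ.+ 1)
      (cong₂ ℤ._+_ (ℤP.*-identityʳ (ℤ.+ m)) (ℤP.*-identityʳ (ℤ.+ n)))))))))

  ι-* : ∀ m n → ι (m ℕ.* n) ≡ ι m * ι n
  ι-* m n = toℚᵘ-injective (ℚᵘP.≃-trans (toℚᵘ-÷ (m ℕ.* n) 0) (ℚᵘP.≃-sym (ℚᵘP.≃-trans (toℚᵘ-homo-* (ι m) (ι n))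
    (ℚᵘP.≃-trans (ℚᵘP.*-cong (toℚᵘ-÷ m 0) (toℚᵘ-÷ n 0)) (ℚᵘ.*≡* (cong (ℤ._* ℤ.+ 1) (sym (ℤP.pos-* m n))))))))

  ÷-* : ∀ m n .{{_ : ℕ.NonZero n}} → (m ÷ n) * ι n ≡ ι m
  ÷-* m (suc n) = toℚᵘ-injective (ℚᵘP.≃-trans (toℚᵘ-homo-* (m ÷ suc n) (ι (suc n)))
    (ℚᵘP.≃-trans (ℚᵘP.*-cong (toℚᵘ-÷ m n) (toℚᵘ-÷ (suc n) 0)) (ℚᵘP.≃-trans (ℚᵘ.*≡* lem) (ℚᵘP.≃-sym (toℚᵘ-÷ m 0)))))
    where
    lem : (ℤ.+ m ℤ.* ℤ.+ suc n) ℤ.* ℤ.+ 1 ≡ ℤ.+ m ℤ.* (ℤ.+ (suc n ℕ.* 1))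
    lem = trans (ℤP.*-identityʳ _) (cong (λ k → ℤ.+ m ℤ.* ℤ.+ k) (sym (ℕP.*-identityʳ (suc n))))

  0≤÷ : ∀ m n → 0ℚ ≤ m ÷ n
  0≤÷ m zero    = ≤-refl
  0≤÷ m (suc n) = toℚᵘ-cancel-≤ (ℚᵘP.≤-respʳ-≃ (ℚᵘP.≃-sym (toℚᵘ-÷ m n))
    (ℚᵘ.*≤* (subst₂ ℤ._≤_ (sym (ℤP.*-zeroˡ (ℤ.+ suc n))) (sym (ℤP.*-identityʳ (ℤ.+ m))) (ℤ.+≤+ ℕ.z≤n))))

  0≤ι : ∀ n → 0ℚ ≤ ι n
  0≤ι n = 0≤÷ n 1

  p≤p+q : ∀ {p q} → 0ℚ ≤ q → p ≤ p + q
  p≤p+q {p} {q} 0≤q = subst (_≤ p + q) (+-identityʳ p) (+-monoʳ-≤ p 0≤q)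

  ι-mono-≤ : ∀ {m n} → m ℕ.≤ n → ι m ≤ ι n
  ι-mono-≤ {m} {n} m≤n = subst (ι m ≤_) (trans (sym (ι-+ m (n ℕ.∸ m))) (cong ι (ℕP.m+[n∸m]≡n m≤n))) (p≤p+q (0≤ι (n ℕ.∸ m)))

  ι-^ : ∀ m n → ι (m ℕ.^ n) ≡ ι m ^ n
  ι-^ m zero    = refl
  ι-^ m (suc n) = trans (ι-* m (m ℕ.^ n)) (cong (ι m *_) (ι-^ m n))

  archimedean : ∀ p → ∃[ n ] p ≤ ι n
  archimedean p@(mkℚ (ℤ.+ m) d-1 _) = m , toℚᵘ-cancel-≤ (ℚᵘP.≤-respʳ-≃ (ℚᵘP.≃-sym (toℚᵘ-÷ m 0))
    (ℚᵘ.*≤* (ℤP.*-monoˡ-≤-nonNeg (ℤ.+ m) (ℤ.+≤+ (ℕ.s≤s ℕ.z≤n)))))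
  archimedean p@(mkℚ ℤ.-[1+ m ] d-1 _) = 0 , ≤-trans (nonPositive⁻¹ p) (0≤ι 0)

  -- Ordered field

  *-monoˡ : ∀ {p q} r → 0ℚ ≤ r → p ≤ q → r * p ≤ r * q
  *-monoˡ r 0≤r = *-monoˡ-≤-nonNeg r {{nonNegative 0≤r}}

  *-monoʳ : ∀ {p q} r → 0ℚ ≤ r → p ≤ q → p * r ≤ q * r
  *-monoʳ r 0≤r = *-monoʳ-≤-nonNeg r {{nonNegative 0≤r}}

  *-mono-≤ : ∀ {p q r s} → 0ℚ ≤ p → 0ℚ ≤ s → p ≤ q → r ≤ s → p * r ≤ q * s
  *-mono-≤ {p} {s = s} 0≤p 0≤s p≤q r≤s = ≤-trans (*-monoˡ p 0≤p r≤s) (*-monoʳ s 0≤s p≤q)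

  0≤* : ∀ {p q} → 0ℚ ≤ p → 0ℚ ≤ q → 0ℚ ≤ p * q
  0≤* {p} {q} 0≤p 0≤q = subst (_≤ p * q) (*-zeroʳ p) (*-monoˡ p 0≤p 0≤q)

  0≤+ : ∀ {p q} → 0ℚ ≤ p → 0ℚ ≤ q → 0ℚ ≤ p + q
  0≤+ = +-mono-≤

  0≤^ : ∀ {p} → 0ℚ ≤ p → ∀ n → 0ℚ ≤ p ^ n
  0≤^ 0≤p zero    = 0≤ι 1
  0≤^ 0≤p (suc n) = 0≤* 0≤p (0≤^ 0≤p n)

  p-q≤r : ∀ {p q r} → p ≤ q + r → p - q ≤ r
  p-q≤r {p} {q} {r} h = subst (p - q ≤_) (solve 2 (λ q r → (q :+ r) :- q := r) refl q r) (+-monoˡ-≤ (- q) h)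

  ∣p-q∣≤r : ∀ {p q r} → p ≤ q + r → q ≤ p + r → ∣ p - q ∣ ≤ r
  ∣p-q∣≤r {p} {q} {r} h h′ with ∣p∣≡p∨∣p∣≡-p (p - q)
  ... | inj₁ e = subst (_≤ r) (sym e) (p-q≤r h)
  ... | inj₂ e = subst (_≤ r) (sym (trans e (solve 2 (λ p q → :- (p :- q) := q :- p) refl p q))) (p-q≤r h′)

  p≤q+∣p-q∣ : ∀ p q → p ≤ q + ∣ p - q ∣
  p≤q+∣p-q∣ p q with ∣p∣≡p∨∣p∣≡-p (p - q)
  ... | inj₁ e = ≤-reflexive (trans (solve 2 (λ p q → p := q :+ (p :- q)) refl p q) (cong (q +_) (sym e)))
  ... | inj₂ e = ≤-trans (p≤p+q (0≤∣p∣ (p - q))) (≤-trans (p≤p+q (0≤∣p∣ (p - q)))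
    (≤-reflexive (trans (cong (λ t → p + t + ∣ p - q ∣) e) (solve 3 (λ p q a → (p :+ :-
        (p :- q)) :+ a := q :+ a) refl p q ∣ p - q ∣))))

  ∣p-q∣-sym : ∀ p q → ∣ p - q ∣ ≡ ∣ q - p ∣
  ∣p-q∣-sym p q = trans (sym (∣-p∣≡∣p∣ (p - q))) (cong ∣_∣ (solve 2 (λ p q → :- (p :- q) := q :- p) refl p q))

  sumℚ : List ℚ → ℚ
  sumℚ = L.foldr _+_ 0ℚ

  ∑ : ∀ {k} → Vector ℚ k → ℚ
  ∑ = foldr _+_ 0ℚ

  difference-* : ∀ p q r s → p * q - r * s ≡ (p - r) * q + r * (q - s)
  difference-* = solve 4 (λ p q r s → p :* q :- r :* s := (p :- r) :* q :+ r :* (q :- s)) refl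

  -- Convergence at rate u

  module Rate {I : Set} (u : I → ℚ) (0≤u : ∀ i → 0ℚ ≤ u i) (u≤1 : ∀ i → u i ≤ 1ℚ) where

    infix 4 _~_

    -- Convergence with one constant for all indices. The index set is a parameter because the trees
    -- H_n and the trees H_(m+1), which have branches, are both used.
    _~_ : (I → ℚ) → ℚ → Set
    f ~ a = ∃[ K ] 0ℚ ≤ K × (∀ i → ∣ f i - a ∣ ≤ K * u i)

    ~-resp : ∀ {f g a b} → f ≗ g → a ≡ b → f ~ a → g ~ b
    ~-resp e refl (K , 0≤K , h) = K , 0≤K , λ i → subst (λ t → ∣ t - _ ∣ ≤ K * u i) (e i) (h i)

    ~-const : ∀ a → (λ _ → a) ~ a
    ~-const a = 0ℚ , ≤-refl , λ i → ≤-reflexive (trans (cong ∣_∣ (+-inverseʳ a)) (sym (*-zeroˡ (u i))))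

    ~-+ : ∀ {f g a b} → f ~ a → g ~ b → (λ i → f i + g i) ~ (a + b)
    ~-+ {f} {g} {a} {b} (K , 0≤K , h) (L , 0≤L , h′) = K + L , 0≤+ 0≤K 0≤L , λ i → ≤-trans
      (≤-reflexive (cong ∣_∣ (solve 4 (λ f g a b → (f :+ g) :- (a :+ b) := (f :- a) :+ (g :- b)) refl (f i) (g i) a b)))
      (≤-trans (∣p+q∣≤∣p∣+∣q∣ (f i - a) (g i - b))
      (≤-trans (+-mono-≤ (h i) (h′ i)) (≤-reflexive (sym (*-distribʳ-+ (u i) K L)))))

    -- Since `u` is at most 1, the rate bound is also a uniform bound, which the product rule needs
    -- for one of its factors.
    ~-bounded : ∀ {f a} → f ~ a → ∃[ B ] 0ℚ ≤ B × (∀ i → ∣ f i ∣ ≤ B)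
    ~-bounded {f} {a} (K , 0≤K , h) = ∣ a ∣ + K , 0≤+ (0≤∣p∣ a) 0≤K , λ i → ≤-trans
      (≤-reflexive (cong ∣_∣ (solve 2 (λ f a → f := a :+ (f :- a)) refl (f i) a)))
      (≤-trans (∣p+q∣≤∣p∣+∣q∣ a (f i - a)) (+-monoʳ-≤ ∣ a ∣ (≤-trans (h i)
        (≤-trans (*-monoˡ K 0≤K (u≤1 i)) (≤-reflexive (*-identityʳ K))))))

    ~-* : ∀ {f g a b} → f ~ a → g ~ b → (λ i → f i * g i) ~ (a * b)
    ~-* {f} {g} {a} {b} (K , 0≤K , h) g~b@(L , 0≤L , h′) = let B , 0≤B , g≤B = ~-bounded {g} g~b in
      K * B + ∣ a ∣ * L , 0≤+ (0≤* 0≤K 0≤B) (0≤* (0≤∣p∣ a) 0≤L) , λ i → ≤-trans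
      (≤-reflexive (cong ∣_∣ (difference-* (f i) (g i) a b)))
      (≤-trans (∣p+q∣≤∣p∣+∣q∣ ((f i - a) * g i) (a * (g i - b)))
      (≤-trans (+-mono-≤
        (≤-trans (≤-reflexive (∣p*q∣≡∣p∣*∣q∣ (f i - a) (g i))) (*-mono-≤ (0≤∣p∣ (f i - a)) 0≤B (h i) (g≤B i)))
        (≤-trans (≤-reflexive (∣p*q∣≡∣p∣*∣q∣ a (g i - b))) (*-monoˡ ∣ a ∣ (0≤∣p∣ a) (h′ i))))
      (≤-reflexive (trans
        (cong₂ _+_ (solve 3 (λ K u B → K :* u :* B := K :* B :* u) refl K (u i) B) (sym (*-assoc ∣ a ∣ L (u i))))
        (sym (*-distribʳ-+ (u i) (K * B) (∣ a ∣ * L)))))))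

    ~-^ : ∀ {f a} n → f ~ a → (λ i → f i ^ n) ~ (a ^ n)
    ~-^ zero    h = ~-const 1ℚ
    ~-^ {f} (suc n) h = ~-* {f} {λ i → f i ^ n} h (~-^ n h)

    ~-∑ : ∀ {k} {f : Fin k → I → ℚ} {a} → (∀ j → f j ~ a j) → (λ i → ∑ (λ j → f j i)) ~ ∑ a
    ~-∑ {zero}  h = ~-const 0ℚ
    ~-∑ {suc k} {f} {a} h = ~-+ {f zero} {λ i → ∑ (λ j → f (suc j) i)} {a zero} {∑ (a ∘ suc)} (h zero)
        (~-∑ {f = f ∘ suc} (h ∘ suc))

    ~-∏ : ∀ {k} {f : Fin k → I → ℚ} {a} → (∀ j → f j ~ a j) → (λ i → ∏ (λ j → f j i)) ~ ∏ a
    ~-∏ {zero}  h = ~-const 1ℚ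
    ~-∏ {suc k} {f} {a} h = ~-* {f zero} {λ i → ∏ (λ j → f (suc j) i)} {a zero} {∏ (a ∘ suc)} (h zero)
        (~-∏ {f = f ∘ suc} (h ∘ suc))

    ~-sum : ∀ {A : Set} {f : A → I → ℚ} {a} xs → (∀ x → f x ~ a x) → (λ i → sumℚ (map (λ x → f x i) xs)) ~ sumℚ (map a xs)
    ~-sum []       h = ~-const 0ℚ
    ~-sum {f = f} {a} (x ∷ xs) h = ~-+ {f x} {λ i → sumℚ (map (λ x → f x i) xs)} {a x} (h x) (~-sum {f = f} {a} xs h)

  -- Finite sums and products

  ι-sum : ∀ {A : Set} (f : A → ℕ) xs → ι (sum (map f xs)) ≡ sumℚ (map (ι ∘ f) xs)
  ι-sum f []       = refl
  ι-sum f (x ∷ xs) = trans (ι-+ (f x) _) (cong (ι (f x) +_) (ι-sum f xs))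

  ι-∑ : ∀ {k} (f : Vector ℕ k) → ι (foldr ℕ._+_ 0 f) ≡ ∑ (ι ∘ f)
  ι-∑ {zero}  f = refl
  ι-∑ {suc k} f = trans (ι-+ (f zero) _) (cong (ι (f zero) +_) (ι-∑ (f ∘ suc)))

  ι-∏ : ∀ {k} (f : Vector ℕ k) → ι (foldr ℕ._*_ 1 f) ≡ ∏ (ι ∘ f)
  ι-∏ {zero}  f = refl
  ι-∏ {suc k} f = trans (ι-* (f zero) _) (cong (ι (f zero) *_) (ι-∏ (f ∘ suc)))

  sumℚ-*ʳ : ∀ {A : Set} (f : A → ℚ) z xs → sumℚ (map f xs) * z ≡ sumℚ (map (λ x → f x * z) xs)
  sumℚ-*ʳ f z []       = *-zeroˡ z
  sumℚ-*ʳ f z (x ∷ xs) = trans (*-distribʳ-+ z (f x) _) (cong (f x * z +_) (sumℚ-*ʳ f z xs))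

  sumℚ-const : ∀ {A : Set} z (xs : List A) → sumℚ (map (λ _ → z) xs) ≡ ι (length xs) * z
  sumℚ-const z []       = sym (*-zeroˡ z)
  sumℚ-const z (x ∷ xs) = trans (cong (z +_) (sumℚ-const z xs))
    (trans (solve 2 (λ z l → z :+ l :* z := (con 1ℚ :+ l) :* z) refl z (ι (length xs)))
    (cong (_* z) (sym (ι-+ 1 (length xs)))))

  ∑-const : ∀ k z → ∑ {k} (λ _ → z) ≡ ι k * z
  ∑-const zero    z = sym (*-zeroˡ z)
  ∑-const (suc k) z = trans (cong (z +_) (∑-const k z))
    (trans (solve 2 (λ z l → z :+ l :* z := (con 1ℚ :+ l) :* z) refl z (ι k))
    (cong (_* z) (sym (ι-+ 1 k))))

  ∑-mono-≤ : ∀ {k} {f g : Vector ℚ k} → (∀ j → f j ≤ g j) → ∑ f ≤ ∑ g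
  ∑-mono-≤ {zero}  h = ≤-refl
  ∑-mono-≤ {suc k} h = +-mono-≤ (h zero) (∑-mono-≤ (h ∘ suc))

  ∣∑∣≤∑∣∣ : ∀ {k} (f : Vector ℚ k) → ∣ ∑ f ∣ ≤ ∑ (∣_∣ ∘ f)
  ∣∑∣≤∑∣∣ {zero}  f = ≤-refl
  ∣∑∣≤∑∣∣ {suc k} f = ≤-trans (∣p+q∣≤∣p∣+∣q∣ (f zero) (∑ (f ∘ suc))) (+-monoʳ-≤ ∣ f zero ∣ (∣∑∣≤∑∣∣ (f ∘ suc)))

  ∏ˡ : (Tree → ℚ) → List Tree → ℚ
  ∏ˡ f = L.foldr (λ t p → f t * p) 1ℚ

  ∏-branches : ∀ (f : Tree∅ → ℚ) → f nothing ≡ 1ℚ → ∀ {k} ts → length ts ℕ.≤ k →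
               ∏ (f ∘ branches k (node ts)) ≡ ∏ˡ (f ∘ just) ts
  ∏-branches f e {zero}  []       _       = refl
  ∏-branches f e {suc k} []       _       = trans (cong (_* A) e) (trans (*-identityˡ A)
    (trans (Prod.sum-cong-≗ {n = k} (λ j → cong (f ∘ head) (sym (drop-[] (toℕ j))))) (∏-branches f e {k} [] z≤n)))
    where A = ∏ {k} (λ j → f (head (drop (toℕ (suc j)) [])))
  ∏-branches f e {suc k} (t ∷ ts) (s≤s p) = cong (f (just t) *_) (∏-branches f e ts p)

  ∏ˡ-^ : ∀ z ts → ∏ˡ (λ t → z ^ leaves t) ts ≡ z ^ leaves* ts
  ∏ˡ-^ z []       = refl
  ∏ˡ-^ z (t ∷ ts) = trans (cong (z ^ leaves t *_) (∏ˡ-^ z ts)) (sym (^-homo-* z (leaves t) (leaves* ts)))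

  1^ : ∀ n → 1ℚ ^ n ≡ 1ℚ
  1^ zero    = refl
  1^ (suc n) = trans (*-identityˡ _) (1^ n)

  module _ {p} (0≤p : 0ℚ ≤ p) (p≤1 : p ≤ 1ℚ) where
    ^≤1 : ∀ n → p ^ n ≤ 1ℚ
    ^≤1 zero    = ≤-refl
    ^≤1 (suc n) = *-mono-≤ 0≤p (0≤ι 1) p≤1 (^≤1 n)

  module _ (d : ℕ) .{{_ : NonTrivial d}} where

    private instance
      d≢0 : NonZero d
      d≢0 = ℕ.nonTrivial⇒nonZero d

    coefficient : Tree → ℚ
    coefficient D = length (proj₁ (representatives (branches d D))) ÷ (d ℕ.^ leaves D ℕ.∸ d)

    -- α D = η D / ‖D‖! is the limit of c D T / ‖T‖^‖D‖, and its recursion is free of multinomials.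
    mutual
      α : Tree → ℚ
      α leaf            = 1ℚ
      α (node (t ∷ ts)) = coefficient (node (t ∷ ts)) * α* (t ∷ ts)

      α* : List Tree → ℚ
      α* []       = 1ℚ
      α* (t ∷ ts) = α t * α* ts

    α∅ : Tree∅ → ℚ
    α∅ = maybe′ α 1ℚ

    α*≡∏ˡ : ∀ ts → α* ts ≡ ∏ˡ α ts
    α*≡∏ˡ []       = refl
    α*≡∏ˡ (t ∷ ts) = cong (α t *_) (α*≡∏ˡ ts)

    -- Proportions of leaves

    u : ℕ → ℚ
    u n = 1 ÷ x d n

    δ : ℚ
    δ = 1 ÷ d

    private
      X : ℕ → ℚ
      X n = ι (x d n)

      δd≡1 : δ * ι d ≡ 1ℚ
      δd≡1 = ÷-* 1 d

      0≤u : ∀ n → 0ℚ ≤ u n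
      0≤u n = 0≤÷ 1 (x d n)

    u*x≡1 : ∀ n → u n * X n ≡ 1ℚ
    u*x≡1 n = ÷-* 1 (x d n) {{ℕ.>-nonZero (x>0 d n)}}

    u*ι≤1 : ∀ n k → k ℕ.≤ x d n → u n * ι k ≤ 1ℚ
    u*ι≤1 n k k≤x = ≤-trans (*-monoˡ (u n) (0≤u n) (ι-mono-≤ k≤x)) (≤-reflexive (u*x≡1 n))

    u≤1 : ∀ n → u n ≤ 1ℚ
    u≤1 n = subst (_≤ 1ℚ) (*-identityʳ (u n)) (u*ι≤1 n 1 (x>0 d n))

    module R  = Rate u 0≤u u≤1
    module R′ = Rate (u ∘ suc) (0≤u ∘ suc) (u≤1 ∘ suc)

    ρ : ℕ → Fin d → ℚ
    ρ m j = X (child d m j) * u (suc m)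

    0≤ρ : ∀ m j → 0ℚ ≤ ρ m j
    0≤ρ m j = 0≤* (0≤ι (x d (child d m j))) (0≤u (suc m))

    -- The inequalities |d x_j - x| ≤ d² are divided by d x; this leaves the constant d.
    ρ~δ : ∀ j → (λ m → ρ m j) R′.~ δ
    ρ~δ j = ι d , 0≤ι d , λ m → let y = X (child d m j) ; v = u (suc m) ; N = X (suc m)
                                    0≤δv = 0≤* (0≤÷ 1 d) (0≤u (suc m)) in
      ∣p-q∣≤r
        (subst₂ _≤_
          (trans (solve 4 (λ δ v D y → δ :* v :* (D :* y) := δ :* D :* (y :* v)) refl δ v (ι d) y) (trans (cong (_*
              (y * v)) δd≡1) (*-identityˡ (y * v))))
          (trans (solve 4 (λ δ v D N → δ :* v :* (N :+ D :* D) := δ :* (v :* N) :+ δ :* D :* (D :* v)) refl δ v (ι d) N)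
            (cong₂ _+_ (trans (cong (δ *_) (u*x≡1 (suc m))) (*-identityʳ δ)) (trans (cong (_* (ι d * v)) δd≡1)
                (*-identityˡ (ι d * v)))))
          (*-monoˡ (δ * v) 0≤δv (subst₂ _≤_ (ι-* d _) (trans (ι-+ (x d (suc m)) _) (cong (N +_) (ι-* d d))) (ι-mono-≤
              (d*child≤ d m j)))))
        (subst₂ _≤_
          (trans (*-assoc δ v N) (trans (cong (δ *_) (u*x≡1 (suc m))) (*-identityʳ δ)))
          (trans (solve 4 (λ δ v D y → δ :* v :* (D :* y :+ D :* D) := δ :* D :* (y :* v :+ D :* v)) refl δ v (ι d) y)
            (trans (cong (_* (y * v + ι d * v)) δd≡1) (*-identityˡ (y * v + ι d * v))))
          (*-monoˡ (δ * v) 0≤δv (subst (N ≤_) (trans (ι-+ (d ℕ.* x d (child d m j)) _) (cong₂ _+_ (ι-* d _) (ι-* d d)))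
              (ι-mono-≤ (≤d*child d m j)))))

    u-child≤ : ∀ m j → u (child d m j) ≤ ι (d ℕ.* d) * u (suc m)
    u-child≤ m j = subst₂ _≤_
      (trans (solve 3 (λ w v N → w :* v :* N := w :* (v :* N)) refl w v N) (trans (cong (w *_) (u*x≡1 (suc m))) (*-identityʳ w)))
      (trans (solve 4 (λ w v D y → w :* v :* (D :* y) := w :* y :* (D :* v)) refl w v D y) (trans (cong (_* (D * v))
          (u*x≡1 (child d m j))) (*-identityˡ (D * v))))
      (*-monoˡ (w * v) (0≤* (0≤u (child d m j)) (0≤u (suc m))) (subst (N ≤_) (ι-* (d ℕ.* d) _) (ι-mono-≤ (≤d²*child d m j))))
      where
      w = u (child d m j)
      v = u (suc m)
      N = X (suc m)
      D = ι (d ℕ.* d)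
      y = X (child d m j)

    ~-child : ∀ {f a} j → f R.~ a → (λ m → f (child d m j)) R′.~ a
    ~-child j (K , 0≤K , h) = K * ι (d ℕ.* d) , 0≤* 0≤K (0≤ι (d ℕ.* d)) , λ m → ≤-trans (h (child d m j))
      (≤-trans (*-monoˡ K 0≤K (u-child≤ m j)) (≤-reflexive (sym (*-assoc K (ι (d ℕ.* d)) (u (suc m))))))

    -- This exact scaling is the reason to measure errors by 1/x rather than by 1/n.
    u*ρ≡u : ∀ m j → u (child d m j) * ρ m j ≡ u (suc m)
    u*ρ≡u m j = trans (sym (*-assoc (u (child d m j)) (X (child d m j)) (u (suc m))))
      (trans (cong (_* u (suc m)) (u*x≡1 (child d m j))) (*-identityˡ (u (suc m))))

    ∑ρ≡1 : ∀ m → ∑ (ρ m) ≡ 1ℚ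
    ∑ρ≡1 m = trans (sym (*-distribʳ-sum (u (suc m)) (λ j → X (child d m j)))) (trans
      (cong (_* u (suc m)) (trans (sym (ι-∑ (λ j → x d (child d m j)))) (cong ι (sym (x-children d m)))))
      (trans (*-comm (X (suc m)) (u (suc m))) (u*x≡1 (suc m))))

    θ : ℚ
    θ = 2 ÷ 3

    ρ≤θ : ∀ m j → ρ m j ≤ θ
    ρ≤θ m j = subst₂ _≤_
      (trans (solve 4 (λ a v b y → a :* v :* (b :* y) := (a :* b) :* (y :* v)) refl (1 ÷ 3) v (ι 3) y) (*-identityˡ (y * v)))
      (trans (solve 4 (λ a v b N → a :* v :* (b :* N) := (a :* b) :* (v :* N)) refl (1 ÷ 3) v (ι 2) N) (trans (cong
          (θ *_) (u*x≡1 (suc m))) (*-identityʳ θ)))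
      (*-monoˡ (1 ÷ 3 * v) (0≤* (0≤÷ 1 3) (0≤u (suc m)))
        (subst₂ _≤_ (ι-* 3 (x d (child d m j))) (ι-* 2 (x d (suc m))) (ι-mono-≤ (3*child≤ d m j))))
      where
      v = u (suc m)
      N = X (suc m)
      y = X (child d m j)

    θ≤1 : θ ≤ 1ℚ
    θ≤1 = ≤-trans (p≤p+q (0≤÷ 1 3)) ≤-refl

    -- One factor is bounded by `θ`, one is kept for the sum of the proportions, and the others are
    -- at most 1.
    ρ^≤θρ : ∀ m j k → ρ m j ^ suc (suc k) ≤ θ * ρ m j
    ρ^≤θρ m j k = *-mono-≤ (0≤ρ m j) (0≤ρ m j) (ρ≤θ m j)
      (≤-trans (*-monoˡ (ρ m j) (0≤ρ m j) (^≤1 (0≤ρ m j) (≤-trans (ρ≤θ m j) θ≤1) k)) (≤-reflexive (*-identityʳ (ρ m j))))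

    child<parent : ∀ m j → x d (child d m j) ℕ.< x d (suc m)
    child<parent m j = ℕP.*-cancelˡ-< 2 _ _ (ℕP.<-≤-trans
      (ℕP.*-monoˡ-< (x d (child d m j)) {{ℕ.>-nonZero (x>0 d (child d m j))}} {2} {3} ℕP.≤-refl) (3*child≤ d m j))

    -- Contraction of the error in the recursion

    module _ (f G : ℕ → ℚ) (a : ℚ) (k : ℕ)
      (f-suc : ∀ m → f (suc m) ≡ ∑ (λ j → f (child d m j) * ρ m j ^ (3 ℕ.+ k)) + G m)
      (fixpoint : (λ m → a * ∑ (λ j → ρ m j ^ (3 ℕ.+ k)) + G m) R′.~ a) where

      private
        C₀   = proj₁ fixpoint
        0≤C₀ = proj₁ (proj₂ fixpoint)
        E₀  = ∣ f 0 - a ∣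
        -- Large enough for the error `E₀` at n = 0, where `u` is 1, and for `C₀` to be at most K/3
        -- = (1 - `θ`) K, which is what the induction step leaves over.
        K   = ι 3 * C₀ + E₀
        F   = λ m → a * ∑ (λ j → ρ m j ^ (3 ℕ.+ k)) + G m

        0≤K : 0ℚ ≤ K
        0≤K = 0≤+ (0≤* (0≤ι 3) 0≤C₀) (0≤∣p∣ (f 0 - a))

        -- The error splits into the errors inherited from the branches and the defect of `a` as a
        -- fixed point.
        difference : ∀ m → f (suc m) - a ≡ ∑ (λ j → (f (child d m j) - a) * ρ m j ^ (3 ℕ.+ k)) + (F m - a)
        difference m = trans (cong (_- a) (f-suc m)) (trans
          (cong (λ s → s + G m - a) split)
          (solve 4 (λ s r a g → s :+ a :* r :+ g :- a := s :+ (a :* r :+ g :- a)) refl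
            (∑ (λ j → (f (child d m j) - a) * ρ m j ^ (3 ℕ.+ k))) (∑ (λ j → ρ m j ^ (3 ℕ.+ k))) a (G m)))
          where
          split : ∑ (λ j → f (child d m j) * ρ m j ^ (3 ℕ.+ k)) ≡
                  ∑ (λ j → (f (child d m j) - a) * ρ m j ^ (3 ℕ.+ k)) + a * ∑ (λ j → ρ m j ^ (3 ℕ.+ k))
          split = trans
            (sum-cong-≗ (λ j → solve 3 (λ f a r → f :* r := (f :- a) :* r :+ a :* r) refl (f (child d m j)) a (ρ m j ^
                (3 ℕ.+ k))))
            (trans (∑-distrib-+ (λ j → (f (child d m j) - a) * ρ m j ^ (3 ℕ.+ k)) (λ j → a * ρ m j ^ (3 ℕ.+ k)))
            (cong (∑ (λ j → (f (child d m j) - a) * ρ m j ^ (3 ℕ.+ k)) +_) (sym (*-distribˡ-sum a (λ j → ρ m j ^ (3 ℕ.+ k))))))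

        -- Of the powers of ρ, one moves the rate from the branch to the tree, one yields `θ`, and
        -- one is left to be summed to 1. This uses up exactly the three that the exponent
        -- guarantees.
        bound-child : ∀ m j → ∣ f (child d m j) - a ∣ ≤ K * u (child d m j) →
                      ∣ (f (child d m j) - a) * ρ m j ^ (3 ℕ.+ k) ∣ ≤ K * u (suc m) * θ * ρ m j
        bound-child m j h = ≤-trans (≤-reflexive (trans (∣p*q∣≡∣p∣*∣q∣ (f (child d m j) - a) (r ^ (3 ℕ.+ k)))
            (cong (∣ f (child d m j) - a ∣ *_) (0≤p⇒∣p∣≡p (0≤^ (0≤ρ m j) (3 ℕ.+ k))))))
          (≤-trans (*-monoʳ (r ^ (3 ℕ.+ k)) (0≤^ (0≤ρ m j) (3 ℕ.+ k)) h)
          (≤-trans (≤-reflexive (trans (solve 4 (λ K w r s → K :* w :* (r :* s) := K :* (w :* r) :* s) refl K (u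
              (child d m j)) r (r ^ (2 ℕ.+ k)))
            (cong (λ w → K * w * r ^ (2 ℕ.+ k)) (u*ρ≡u m j))))
          (≤-trans (*-monoˡ (K * u (suc m)) (0≤* 0≤K (0≤u (suc m))) (ρ^≤θρ m j k))
          (≤-reflexive (sym (*-assoc (K * u (suc m)) θ r))))))
          where r = ρ m j

        -- Strong induction on the number of leaves, with `b` as the bound that decreases.
        bound : ∀ b n → x d n ℕ.≤ b → ∣ f n - a ∣ ≤ K * u n
        bound zero    n       x≤b = contradiction (ℕP.≤-trans (x>0 d n) x≤b) λ ()
        bound (suc b) zero    _   = ≤-trans (subst (E₀ ≤_) (+-comm E₀ (ι 3 * C₀)) (p≤p+q (0≤* (0≤ι 3) 0≤C₀)))
          (≤-reflexive (sym (*-identityʳ K)))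
        bound (suc b) (suc m) x≤b = ≤-trans (≤-reflexive (cong ∣_∣ (difference m)))
          (≤-trans (∣p+q∣≤∣p∣+∣q∣ (∑ (λ j → (f (child d m j) - a) * ρ m j ^ (3 ℕ.+ k))) (F m - a))
          (≤-trans (+-mono-≤
            (≤-trans (∣∑∣≤∑∣∣ (λ j → (f (child d m j) - a) * ρ m j ^ (3 ℕ.+ k)))
            (≤-trans (∑-mono-≤ (λ j → bound-child m j (bound b (child d m j) (ℕP.≤-pred (ℕP.≤-trans (child<parent m j) x≤b)))))
            (≤-reflexive (trans (sym (*-distribˡ-sum (K * u (suc m) * θ) (ρ m)))
              (trans (cong (K * u (suc m) * θ *_) (∑ρ≡1 m)) (*-identityʳ (K * u (suc m) * θ)))))))
            (proj₂ (proj₂ fixpoint) m))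
          (≤-trans (≤-reflexive (solve 4 (λ K v θ c → K :* v :* θ :+ c :* v := (θ :* K :+ c) :* v) refl K (u (suc m)) θ C₀))
          (*-monoʳ (u (suc m)) (0≤u (suc m)) θK+C₀≤K))))
          where
          θK+C₀≤K : θ * K + C₀ ≤ K
          θK+C₀≤K = ≤-trans (+-monoʳ-≤ (θ * K) (≤-trans
              (≤-reflexive (trans (sym (*-identityˡ C₀)) (*-assoc (1 ÷ 3) (ι 3) C₀)))
              (*-monoˡ (1 ÷ 3) (0≤÷ 1 3) (p≤p+q {ι 3 * C₀} (0≤∣p∣ (f 0 - a))))))
            (≤-reflexive (trans (sym (*-distribʳ-+ K θ (1 ÷ 3))) (*-identityˡ K)))

      contraction : f R.~ a
      contraction = K , 0≤K , λ n → bound (x d n) n ℕP.≤-refl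

  -- From the rate O(1/n) to the limit

  0<1÷ : ∀ n .{{_ : NonZero n}} → 0ℚ < 1 ÷ n
  0<1÷ (suc n) = toℚᵘ-cancel-< (ℚᵘP.<-respʳ-≃ (ℚᵘP.≃-sym (toℚᵘ-÷ 1 n)) (ℚᵘ.*<* (ℤ.+<+ (s≤s z≤n))))

  1÷≡ : ∀ n .{{_ : NonZero n}} → 1 ÷ n ≡ ℤ.+ 1 / n
  1÷≡ (suc n) = refl

  IsO⇒⟶ : ∀ f l → IsO[1/n] (λ n → f n - l) → f ⟶ l
  IsO⇒⟶ f l (K , N , h) ε 0<ε = N ℕ.+ suc m , λ n N+m<n →
      let m<n = ℕP.≤-trans (ℕP.m≤n+m (suc m) N) N+m<n
          instance _ = ℕ.>-nonZero (ℕP.≤-trans (s≤s z≤n) m<n)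
      in ≤-<-trans (≤-trans (h n (ℕP.≤-trans (ℕP.m≤m+n N (suc m)) N+m<n)) (≤-reflexive (cong (K *_) (sym (1÷≡ n)))))
         (<-≤-trans (Kv< n m<n) (bound n m<n))
    where
    instance
      ε>0 = positive 0<ε
      ε≢0 = pos⇒nonZero ε
    m = proj₁ (archimedean (K * (1/ ε)))
    K≤ : K ≤ ι m * ε
    K≤ = ≤-trans (≤-reflexive (sym (trans (*-assoc K (1/ ε) ε) (trans (cong (K *_) (*-inverseˡ ε)) (*-identityʳ K)))))
      (*-monoʳ ε (<⇒≤ 0<ε) (proj₂ (archimedean (K * (1/ ε)))))
    module _ (n : ℕ) (m<n : m ℕ.< n) where
      instance
        n≢0 : NonZero n
        n≢0 = ℕ.>-nonZero (ℕP.≤-trans (s≤s z≤n) m<n)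
      -- Enlarging K by ε makes the inequality strict whatever the sign of K; since K ≤ m ε, the
      -- condition n ≥ m + 1 absorbs the enlargement.
      Kv< : K * (1 ÷ n) < (K + ε) * (1 ÷ n)
      Kv< = *-monoˡ-<-pos (1 ÷ n) {{positive (0<1÷ n)}} (subst (_< K + ε) (+-identityʳ K) (+-monoʳ-< K 0<ε))
      bound : (K + ε) * (1 ÷ n) ≤ ε
      bound = ≤-trans (*-monoʳ (1 ÷ n) (0≤÷ 1 n) (≤-trans (+-monoˡ-≤ ε K≤)
          (≤-trans (≤-reflexive (trans (solve 2 (λ m ε → m :* ε :+ ε := (con 1ℚ :+ m) :* ε) refl (ι m) ε) (cong (_* ε)
              (sym (ι-+ 1 m)))))
          (*-monoʳ ε (<⇒≤ 0<ε) (ι-mono-≤ m<n)))))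
        (≤-reflexive (trans (solve 3 (λ n ε v → n :* ε :* v := v :* n :* ε) refl (ι n) ε (1 ÷ n))
          (trans (cong (_* ε) (÷-* 1 n)) (*-identityˡ ε))))

  -- The recursion for the normalised counts and its limit

  module _ (d : ℕ) .{{_ : NonTrivial d}} where

    private instance
      d≢0 : NonZero d
      d≢0 = ℕ.nonTrivial⇒nonZero d

    private
      module R₀ = R d
      module R₁ = R′ d
      v = u d
      X : ℕ → ℚ
      X n = ι (x d n)
      0≤v : ∀ n → 0ℚ ≤ v n
      0≤v n = 0≤÷ 1 (x d n)

    contraction-≥3 : ∀ {k} → 3 ℕ.≤ k → (f G : ℕ → ℚ) (a : ℚ) →
      (∀ m → f (suc m) ≡ ∑ (λ j → f (child d m j) * ρ d m j ^ k) + G m) →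
      (λ m → a * ∑ (λ j → ρ d m j ^ k) + G m) R₁.~ a → f R₀.~ a
    contraction-≥3 {suc (suc (suc k))} _ f G a = contraction d f G a k
    contraction-≥3 {suc zero}       (s≤s ())
    contraction-≥3 {suc (suc zero)} (s≤s (s≤s ()))

    -- The count divided by x to the power of the size of `D`, expressed by a power of `u` so that
    -- it can be rescaled by multiplication.
    g : Tree∅ → ℕ → ℚ
    g D n = ι (c D (H d n)) * u d n ^ ‖ D ‖

    g-rescale : ∀ w m j → ι (c w (H d (child d m j))) * u d (suc m) ^ ‖ w ‖ ≡ g w (child d m j) * ρ d m j ^ ‖ w ‖
    g-rescale w m j = trans
      (cong (ι (c w (H d (child d m j))) *_) (trans (cong (_^ ‖ w ‖) (sym (u*ρ≡u d m j))) (^-distrib-* (u d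
          (child d m j)) (ρ d m j) ‖ w ‖)))
      (sym (*-assoc (ι (c w (H d (child d m j)))) (u d (child d m j) ^ ‖ w ‖) (ρ d m j ^ ‖ w ‖)))

    module _ {t : Tree} {ts : List Tree} (2≤ : 2 ℕ.≤ length (t ∷ ts)) (≤d : length (t ∷ ts) ℕ.≤ d) where

      private
        ds = t ∷ ts
        D  = node ds
        k  = leaves D
        B  = branches d D
        M  = proj₁ (representatives B)

      ∏-^-permute : ∀ z (π : Permutation′ d) → ∏ (λ j → z ^ ‖ B (π ⟨$⟩ʳ j) ‖) ≡ z ^ k
      ∏-^-permute z π = trans (sym (Prod.sum-permute (λ j → z ^ ‖ B j ‖) π))
        (trans (∏-branches (λ w → z ^ ‖ w ‖) refl ds ≤d) (∏ˡ-^ z ds))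

      -- A product over all branches does not feel the order, so every representative contributes
      -- the same limit and the sum over `M` becomes the factor |M(D)|.
      ∏-α-permute : ∀ (π : Permutation′ d) → ∏ (λ j → α∅ d (B (π ⟨$⟩ʳ j))) ≡ α* d ds
      ∏-α-permute π = trans (sym (Prod.sum-permute (λ j → α∅ d (B j)) π))
        (trans (∏-branches (α∅ d) refl ds ≤d) (sym (α*≡∏ˡ d ds)))

      -- The share of the sets whose most recent common ancestor is the root. It involves only the
      -- branches of `D`, whose limits are known by induction.
      G : ℕ → ℚ
      G m = sumℚ (map (λ π → ∏ (λ j → g (B (π ⟨$⟩ʳ j)) (child d m j) * ρ d m j ^ ‖ B (π ⟨$⟩ʳ j) ‖)) M)

      g-recursion : ∀ m → g (just D) (suc m) ≡ ∑ (λ j → g (just D) (child d m j) * ρ d m j ^ k) + G m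
      g-recursion m = begin
        ι (c (just D) (H d (suc m))) * z
          ≡⟨ cong (_* z) (trans (cong ι (trans (cong (c (just D)) (H-children d m)) (c-recursion 2≤ ≤d (proj₂
              (representatives B)) T))) (ι-+ S₁ S₂)) ⟩
        (ι S₁ + ι S₂) * z
          ≡⟨ *-distribʳ-+ z (ι S₁) (ι S₂) ⟩
        ι S₁ * z + ι S₂ * z
          ≡⟨ cong₂ _+_ (trans (cong (_* z) (ι-sum W M)) (trans (sumℚ-*ʳ (ι ∘ W) z M) (cong sumℚ (map-cong spread M))))
                       (trans (cong (_* z) (ι-∑ (λ j → c (just D) (T j)))) (trans (*-distribʳ-sum z (λ j → ι (c (just D)
                           (T j)))) (sum-cong-≗ (g-rescale (just D) m)))) ⟩
        G m + ∑ (λ j → g (just D) (child d m j) * ρ d m j ^ k)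
          ≡⟨ +-comm (G m) (∑ (λ j → g (just D) (child d m j) * ρ d m j ^ k)) ⟩
        ∑ (λ j → g (just D) (child d m j) * ρ d m j ^ k) + G m ∎
        where
        open ≡-Reasoning
        z = u d (suc m) ^ k
        T : Vector Tree d
        T j = H d (child d m j)
        W : Permutation′ d → ℕ
        W π = foldr ℕ._*_ 1 (λ j → c (B (π ⟨$⟩ʳ j)) (T j))
        S₁ = sum (map W M)
        S₂ = foldr ℕ._+_ 0 (λ j → c (just D) (T j))
        spread : ∀ π → ι (W π) * z ≡ ∏ (λ j → g (B (π ⟨$⟩ʳ j)) (child d m j) * ρ d m j ^ ‖ B (π ⟨$⟩ʳ j) ‖)
        spread π = trans (cong₂ _*_ (ι-∏ (λ j → c (B (π ⟨$⟩ʳ j)) (T j))) (sym (∏-^-permute (u d (suc m)) π)))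
          (trans (sym (Prod.∑-distrib-+ (λ j → ι (c (B (π ⟨$⟩ʳ j)) (T j))) (λ j → u d (suc m) ^ ‖ B (π ⟨$⟩ʳ j) ‖)))
          (Prod.sum-cong-≗ (λ j → g-rescale (B (π ⟨$⟩ʳ j)) m j)))

      -- With all proportions equal to 1/d the recursion reads a d^(1-k) + |M(D)| A d^(-k) = a,
      -- where A is the product over the branches. Multiplied by d^k, this is the definition of `α`,
      -- as d^k - d is nonzero for k ≥ 2.
      α-fixpoint : α d D * ∑ {d} (λ _ → δ d ^ k) + sumℚ (map (λ π → ∏ (λ j → α∅ d (B (π ⟨$⟩ʳ j)) * δ d ^ ‖ B
          (π ⟨$⟩ʳ j) ‖)) M) ≡ α d D
      α-fixpoint = begin
        a * ∑ {d} (λ _ → q) + sumℚ (map (λ π → ∏ (λ j → α∅ d (B (π ⟨$⟩ʳ j)) * δ d ^ ‖ B (π ⟨$⟩ʳ j) ‖)) M)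
          ≡⟨ cong₂ _+_ (cong (a *_) (∑-const d q)) (trans (cong sumℚ (map-cong spread M)) (sumℚ-const (A * q) M)) ⟩
        a * (ι d * q) + ι (length M) * (A * q)
          ≡⟨ cong (λ l → a * (ι d * q) + l * (A * q)) (sym (÷-* (length M) E)) ⟩
        a * (ι d * q) + cf * ι E * (A * q)
          ≡⟨ solve 5 (λ c A d q E → c :* A :* (d :* q) :+ c :* E :* (A :* q) := c :* A :* (q :* (d :+ E))) refl cf A
              (ι d) q (ι E) ⟩
        a * (q * (ι d + ι E))
          ≡⟨ cong (λ s → a * (q * s)) (trans (sym (ι-+ d E)) (trans (cong ι (ℕP.m+[n∸m]≡n d≤d^k)) (ι-^ d k))) ⟩
        a * (q * ι d ^ k)
          ≡⟨ cong (a *_) (trans (sym (^-distrib-* (δ d) (ι d) k)) (trans (cong (_^ k) (÷-* 1 d)) (1^ k))) ⟩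
        a * 1ℚ
          ≡⟨ *-identityʳ a ⟩
        a ∎
        where
        open ≡-Reasoning
        a = α d D
        A = α* d ds
        q = δ d ^ k
        E = d ℕ.^ k ℕ.∸ d
        cf = coefficient d D
        d<d^k : d ℕ.< d ℕ.^ k
        d<d^k = subst (ℕ._< d ℕ.^ k) (ℕP.*-identityʳ d) (ℕP.^-monoʳ-< d (ℕ.nonTrivial⇒n>1 d) (ℕP.≤-trans 2≤ (length≤leaves* ds)))
        d≤d^k = ℕP.<⇒≤ d<d^k
        instance
          E≢0 : NonZero E
          E≢0 = ℕ.>-nonZero (ℕP.m<n⇒0<n∸m d<d^k)
        spread : ∀ π → ∏ (λ j → α∅ d (B (π ⟨$⟩ʳ j)) * δ d ^ ‖ B (π ⟨$⟩ʳ j) ‖) ≡ A * q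
        spread π = trans (Prod.∑-distrib-+ (λ j → α∅ d (B (π ⟨$⟩ʳ j))) (λ j → δ d ^ ‖ B (π ⟨$⟩ʳ j) ‖))
          (cong₂ _*_ (∏-α-permute π) (∏-^-permute (δ d) π))

      g~α-node : 3 ℕ.≤ k → (∀ j → g (B j) R₀.~ α∅ d (B j)) → g (just D) R₀.~ α d D
      g~α-node 3≤k h = contraction-≥3 3≤k (g (just D)) G (α d D) g-recursion
        (R₁.~-resp {λ m → α d D * ∑ (λ j → ρ d m j ^ k) + G m} (λ _ → refl) α-fixpoint
          (R₁.~-+ {λ m → α d D * ∑ (λ j → ρ d m j ^ k)} {G}
            (R₁.~-* {λ _ → α d D} {λ m → ∑ (λ j → ρ d m j ^ k)} (R₁.~-const (α d D))
              (R₁.~-∑ {f = λ j m → ρ d m j ^ k} (λ j → R₁.~-^ {λ m → ρ d m j} k (ρ~δ d j))))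
            (R₁.~-sum {f = λ π m → ∏ (λ j → g (B (π ⟨$⟩ʳ j)) (child d m j) * ρ d m j ^ ‖ B (π ⟨$⟩ʳ j) ‖)}
                      {λ π → ∏ (λ j → α∅ d (B (π ⟨$⟩ʳ j)) * δ d ^ ‖ B (π ⟨$⟩ʳ j) ‖)} M
              (λ π → R₁.~-∏ {f = λ j m → g (B (π ⟨$⟩ʳ j)) (child d m j) * ρ d m j ^ ‖ B (π ⟨$⟩ʳ j) ‖}
                (λ j → R₁.~-* {λ m → g (B (π ⟨$⟩ʳ j)) (child d m j)} {λ m → ρ d m j ^ ‖ B (π ⟨$⟩ʳ j) ‖}
                  (~-child d {g (B (π ⟨$⟩ʳ j))} j (h (π ⟨$⟩ʳ j)))
                  (R₁.~-^ {λ m → ρ d m j} ‖ B (π ⟨$⟩ʳ j) ‖ (ρ~δ d j)))))))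

    -- Falling factorials against powers, and the small trees

    falling : ℕ → ℕ → ℚ
    falling k n = ι (x d n P′ k) * u d n ^ k

    -- Each factor (x - k) / x is within k / x of 1. With the truncated difference this holds for x
    -- < k as well, hence at every index.
    falling~1 : ∀ k → falling k R₀.~ 1ℚ
    falling~1 zero    = R₀.~-const 1ℚ
    falling~1 (suc k) = R₀.~-resp {λ n → ι (x d n ℕ.∸ k) * u d n * falling k n} {a = 1ℚ}
      (λ n → sym (trans (cong (_* (u d n * u d n ^ k)) (ι-* (x d n ℕ.∸ k) (x d n P′ k)))
        (solve 4 (λ a p u q → a :* p :* (u :* q) := a :* u :* (p :* q)) refl (ι (x d n ℕ.∸ k)) (ι (x d n P′ k)) (u d n)
            (u d n ^ k))))
      refl
      (R₀.~-* {λ n → ι (x d n ℕ.∸ k) * u d n} {falling k} {1ℚ} {1ℚ} factor (falling~1 k))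
      where
      factor : (λ n → ι (x d n ℕ.∸ k) * u d n) R₀.~ 1ℚ
      factor = ι k , 0≤ι k , λ n → ∣p-q∣≤r
        (≤-trans (≤-reflexive (*-comm (ι (x d n ℕ.∸ k)) (u d n))) (≤-trans (u*ι≤1 d n (x d n ℕ.∸ k) (ℕP.m∸n≤m
            (x d n) k)) (p≤p+q (0≤* (0≤ι k) (0≤v n)))))
        (≤-trans (≤-reflexive (trans (sym (u*x≡1 d n)) (*-comm (u d n) (X n))))
          (≤-trans (*-monoʳ (u d n) (0≤v n) (ι-mono-≤ (ℕP.≤-trans (ℕP.m≤n+m∸n (x d n) k) (ℕP.≤-reflexive (ℕP.+-comm k
              (x d n ℕ.∸ k))))))
          (≤-reflexive (trans (cong (_* u d n) (ι-+ (x d n ℕ.∸ k) k)) (*-distribʳ-+ (u d n) (ι (x d n ℕ.∸ k)) (ι k))))))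

    -- Evaluating the recursion of c at the star with d leaves counts the representatives for the cherry.
    length-representatives-cherry : length (proj₁ (representatives (branches d cherry))) ≡ d C 2
    length-representatives-cherry = sym (begin
      d C 2                                          ≡⟨ cong (_C 2) (sym leaves-star) ⟩
      leaves star C 2                                ≡⟨ c-cherry star ⟨
      c (just cherry) star                           ≡⟨ c-recursion (s≤s (s≤s z≤n)) (ℕ.nonTrivial⇒n>1 d) (proj₂
          (representatives B)) (λ _ → leaf) ⟩
      sum (map (λ π → foldr ℕ._*_ 1 (λ j → c (B (π ⟨$⟩ʳ j)) leaf)) M) ℕ.+ foldr ℕ._+_ 0 {d} (λ _ → 0)
                                                     -- A single leaf contains the empty tree once,
                                                     -- the leaf once and the cherry never, so each
                                                     -- representative counts 1 and the second sum
                                                     -- vanishes.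
                                                     ≡⟨ cong₂ ℕ._+_ (trans (cong sum (map-cong (λ π → all-one (λ j → B
                                                         (π ⟨$⟩ʳ j)) (λ j → c-B (toℕ (π ⟨$⟩ʳ j)))) M)) (sum-ones M)) (zeros d) ⟩
      length M ℕ.+ 0                                 ≡⟨ ℕP.+-identityʳ (length M) ⟩
      length M                                       ∎)
      where
      open ≡-Reasoning
      B = branches d cherry
      M = proj₁ (representatives B)
      star = node (tabulate {n = d} (λ _ → leaf))
      ones : ∀ k → foldr ℕ._+_ 0 {k} (λ _ → 1) ≡ k
      ones zero    = refl
      ones (suc k) = cong suc (ones k)
      zeros : ∀ k → foldr ℕ._+_ 0 {k} (λ _ → 0) ≡ 0
      zeros zero    = refl
      zeros (suc k) = zeros k
      leaves-star : leaves star ≡ d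
      leaves-star = trans (leaves-node* {tabulate {n = d} (λ _ → leaf)} (ℕP.≤-trans (ℕ.>-nonZero⁻¹ d) (ℕP.≤-reflexive
          (sym (length-tabulate {n = d} (λ _ → leaf))))))
        (trans (leaves*-tabulate {d} (λ _ → leaf)) (ones d))
      c-B : ∀ i → c (head (drop i (leaf ∷ leaf ∷ []))) leaf ≡ 1
      c-B zero                = refl
      c-B (suc zero)          = refl
      c-B (suc (suc zero))    = refl
      c-B (suc (suc (suc i))) = refl
      all-one : ∀ {k} (w : Vector Tree∅ k) → (∀ j → c (w j) leaf ≡ 1) → foldr ℕ._*_ 1 (λ j → c (w j) leaf) ≡ 1
      all-one {zero}  w h = refl
      all-one {suc k} w h = cong₂ ℕ._*_ (h zero) (all-one (w ∘ suc) (h ∘ suc))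
      sum-ones : ∀ {A : Set} (xs : List A) → sum (map (λ _ → 1) xs) ≡ length xs
      sum-ones []       = refl
      sum-ones (_ ∷ xs) = cong suc (sum-ones xs)

    -- The quotient of C(d, 2) by d² - d, as 2 C(d, 2) = d (d - 1).
    α-cherry : α d cherry ≡ ½
    α-cherry = begin
      cf * 1ℚ                  ≡⟨ *-identityʳ cf ⟩
      cf                       ≡⟨ solve 1 (λ c → c := c :* con (ι 2) :* con ½) refl cf ⟩
      cf * ι 2 * ½             ≡⟨ cong (_* ½) cf*2≡1 ⟩
      1ℚ * ½                   ≡⟨ *-identityˡ ½ ⟩
      ½                        ∎
      where
      open ≡-Reasoning
      cf = coefficient d cherry
      l  = length (proj₁ (representatives (branches d cherry)))
      E  = d ℕ.^ 2 ℕ.∸ d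
      l*2≡E : l ℕ.* 2 ≡ E
      l*2≡E = trans (cong (ℕ._* 2) length-representatives-cherry) (trans (nCk*k!≡nP′k d 2) (trans
        (cong ((d ℕ.∸ 1) ℕ.*_) (ℕP.*-identityʳ d))
        (trans (ℕP.*-distribʳ-∸ d d 1) (cong₂ ℕ._∸_ (cong (d ℕ.*_) (sym (ℕP.*-identityʳ d))) (ℕP.*-identityˡ d)))))
      instance
        E≢0 : NonZero E
        E≢0 = ℕ.>-nonZero (ℕP.m<n⇒0<n∸m (subst (ℕ._< d ℕ.^ 2) (ℕP.*-identityʳ d) (ℕP.^-monoʳ-< d
            (ℕ.nonTrivial⇒n>1 d) {1} {2} (s≤s (s≤s z≤n)))))
      cf*2≡1 : cf * ι 2 ≡ 1ℚ
      cf*2≡1 = begin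
        (l ÷ E) * ι 2                   ≡⟨ *-comm (l ÷ E) (ι 2) ⟩
        ι 2 * (l ÷ E)                   ≡⟨ cong (ι 2 *_) (trans (sym (*-identityʳ (l ÷ E))) (cong ((l ÷ E) *_) (sym
            (trans (*-comm (ι E) (1 ÷ E)) (÷-* 1 E))))) ⟩
        ι 2 * ((l ÷ E) * (ι E * (1 ÷ E))) ≡⟨ cong (ι 2 *_) (trans (sym (*-assoc (l ÷ E) (ι E) (1 ÷ E))) (cong (_*
            (1 ÷ E)) (÷-* l E))) ⟩
        ι 2 * (ι l * (1 ÷ E))           ≡⟨ solve 3 (λ t l e → t :* (l :* e) := e :* (l :* t)) refl (ι 2) (ι l) (1 ÷ E) ⟩
        (1 ÷ E) * (ι l * ι 2)           ≡⟨ cong ((1 ÷ E) *_) (trans (sym (ι-* l 2)) (cong ι l*2≡E)) ⟩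
        (1 ÷ E) * ι E                   ≡⟨ ÷-* 1 E ⟩
        1ℚ                              ∎

    g~α-nothing : g nothing R₀.~ 1ℚ
    g~α-nothing = R₀.~-resp {λ _ → 1ℚ} {a = 1ℚ} (λ n → sym (cong (λ c → ι c * 1ℚ) (c-nothing (H d n)))) refl (R₀.~-const 1ℚ)

    g~α-leaf : g (just leaf) R₀.~ 1ℚ
    g~α-leaf = R₀.~-resp {λ _ → 1ℚ} {a = 1ℚ} (λ n → sym (trans (cong₂ (λ c w → ι c * w) (c-leaf (H d n)) (*-identityʳ
        (u d n))) (trans (*-comm (X n) (u d n)) (u*x≡1 d n)))) refl (R₀.~-const 1ℚ)

    g~α-cherry : g (just cherry) R₀.~ α d cherry
    g~α-cherry = R₀.~-resp {λ n → ½ * falling 2 n} {g (just cherry)} {½ * 1ℚ}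
      (λ n → sym (trans (cong (λ c → ι c * u d n ^ 2) (c-cherry (H d n)))
        (trans (solve 2 (λ c w → c :* w := con ½ :* (c :* con (ι 2) :* w)) refl (ι (x d n C 2)) (u d n ^ 2))
        (cong (λ c → ½ * (c * u d n ^ 2)) (trans (sym (ι-* (x d n C 2) 2)) (cong ι (nCk*k!≡nP′k (x d n) 2)))))))
      (trans (*-identityʳ ½) (sym α-cherry))
      (R₀.~-* {λ _ → ½} {falling 2} {½} {1ℚ} (R₀.~-const ½) (falling~1 2))

    mutual
      g~α : ∀ {D} → Dary d D → g (just D) R₀.~ α d D
      g~α single = g~α-leaf
      g~α {D@(node (t ∷ ts))} D-dary@(internal 2≤ ≤d ds) with leaves D ℕP.≟ 2
      ... | yes k≡2 = subst (λ D → g (just D) R₀.~ α d D) (sym (Branching-2 (Dary⇒Branching D-dary) k≡2)) g~α-cherry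
      ... | no  k≢2 = g~α-node 2≤ ≤d (ℕP.≤∧≢⇒< (ℕP.≤-trans 2≤ (length≤leaves* (t ∷ ts))) (k≢2 ∘ sym)) (λ j → g~α* ds (toℕ j))

      -- Stated for every position, also past the end, to cover the padding of the branches; the
      -- induction stays structural in the derivation of `Dary`.
      g~α* : ∀ {ts} → All (Dary d) ts → ∀ i → g (head (drop i ts)) R₀.~ α∅ d (head (drop i ts))
      g~α* []       zero    = g~α-nothing
      g~α* []       (suc i) = g~α-nothing
      g~α* (t ∷ ts) zero    = g~α t
      g~α* (t ∷ ts) (suc i) = g~α* ts i

    g~α∅ : ∀ {D} → Dary∅ d D → g D R₀.~ α∅ d D
    g~α∅ nothing  = g~α-nothing
    g~α∅ (just D) = g~α D

    -- From normalised counts to densities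

    η : Tree∅ → ℚ
    η D = ι (‖ D ‖ !) * α∅ d D

    -- With p = k! C(x, k) / x^k one has γ p = k! g, so (γ - η) p is a combination of the errors of
    -- g and of p. As soon as p ≥ 1/2, dividing by p at most doubles the bound.
    γ-IsO : ∀ D → g D R₀.~ α∅ d D → IsO[1/n] (λ n → γ D (H d n) - η D)
    γ-IsO D (K , 0≤K , h) = ι 2 * L , N , bound
      where
      k = ‖ D ‖
      a = α∅ d D
      F = ι (k !)
      Q   = proj₁ (falling~1 k)
      0≤Q = proj₁ (proj₂ (falling~1 k))
      L = F * K + Q * ∣ η D ∣
      0≤L : 0ℚ ≤ L
      0≤L = 0≤+ (0≤* (0≤ι (k !)) 0≤K) (0≤* 0≤Q (0≤∣p∣ (η D)))
      -- For n ≥ 2Q the error Q/x of p is at most 1/2, because x ≥ n.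
      N = proj₁ (archimedean (ι 2 * Q))
      module _ (n : ℕ) .{{_ : NonZero n}} (N≤n : N ℕ.≤ n) where
        p = falling k n
        w = u d n
        Qw≤½ : Q * w ≤ ½
        Qw≤½ = ≤-trans (≤-reflexive (solve 2 (λ Q w → Q :* w := con ½ :* (w :* (con (ι 2) :* Q))) refl Q w))
          (*-monoˡ ½ (0≤÷ 1 2) (≤-trans (*-monoˡ w (0≤v n) (proj₂ (archimedean (ι 2 * Q)))) (u*ι≤1 d n N (ℕP.≤-trans N≤n
              (n≤x d n)))))
        ½≤p : ½ ≤ p
        ½≤p = ≤-trans (p-q≤r {1ℚ} {½} {p} (≤-trans (p≤q+∣p-q∣ 1ℚ p) (≤-trans (+-monoʳ-≤ p (≤-trans (≤-reflexive (∣p-q∣-sym 1ℚ p))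
          (≤-trans (proj₂ (proj₂ (falling~1 k)) n) Qw≤½))) (≤-reflexive (+-comm p ½))))) ≤-refl
        -- Excludes the dummy value of `÷`: a vanishing binomial coefficient would make p vanish,
        -- against p ≥ 1/2.
        C≢0 : NonZero (x d n C k)
        C≢0 = ℕ.≢-nonZero λ C≡0 → <-irrefl refl (<-≤-trans (0<1÷ 2) (≤-trans ½≤p (≤-reflexive
          (trans (cong (λ q → ι q * w ^ k) (trans (sym (nCk*k!≡nP′k (x d n) k)) (cong (ℕ._* k !) C≡0))) (*-zeroˡ (w ^ k))))))
        γp≡Fg : γ D (H d n) * p ≡ F * g D n
        γp≡Fg = trans (cong (λ q → γ D (H d n) * (q * w ^ k)) (trans (cong ι (sym (nCk*k!≡nP′k (x d n) k))) (ι-*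
            (x d n C k) (k !))))
          (trans (solve 4 (λ γ C F w → γ :* (C :* F :* w) := F :* (γ :* C :* w)) refl (γ D (H d n)) (ι (x d n C k)) F (w ^ k))
          (cong (λ c → F * (c * w ^ k)) (÷-* (c D (H d n)) (x d n C k) {{C≢0}})))
        difference : (γ D (H d n) - η D) * p ≡ F * (g D n - a) + (p - 1ℚ) * (- η D)
        difference = trans (solve 3 (λ γ η p → (γ :- η) :* p := γ :* p :- η :* p) refl (γ D (H d n)) (η D) p)
          (trans (cong (_- η D * p) γp≡Fg)
          (solve 4 (λ F g a p → F :* g :- F :* a :* p := F :* (g :- a) :+ (p :- con 1ℚ) :* (:- (F :* a))) refl F (g D n) a p))
        ∣difference∣≤ : ∣ (γ D (H d n) - η D) * p ∣ ≤ L * w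
        ∣difference∣≤ = ≤-trans (≤-reflexive (cong ∣_∣ difference))
          (≤-trans (∣p+q∣≤∣p∣+∣q∣ (F * (g D n - a)) ((p - 1ℚ) * (- η D)))
          (≤-trans (+-mono-≤
            (≤-trans (≤-reflexive (trans (∣p*q∣≡∣p∣*∣q∣ F (g D n - a)) (cong (_* ∣ g D n - a ∣) (0≤p⇒∣p∣≡p (0≤ι
                (k !)))))) (*-monoˡ F (0≤ι (k !)) (h n)))
            (≤-trans (≤-reflexive (trans (∣p*q∣≡∣p∣*∣q∣ (p - 1ℚ) (- η D)) (cong (∣ p - 1ℚ ∣ *_) (∣-p∣≡∣p∣ (η D)))))
                (*-monoʳ ∣ η D ∣ (0≤∣p∣ (η D)) (proj₂ (proj₂ (falling~1 k)) n))))
          (≤-reflexive (solve 5 (λ F K w Q e → F :* (K :* w) :+ Q :* w :* e := (F :* K :+ Q :* e) :* w) refl F K w Q ∣ η D ∣))))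
        w≤1/n : w ≤ 1 ÷ n
        w≤1/n = ≤-trans (≤-reflexive (trans (sym (*-identityʳ w)) (trans (cong (w *_) (sym (trans (*-comm (ι n) (1 ÷ n))
            (÷-* 1 n)))) (sym (*-assoc w (ι n) (1 ÷ n))))))
          (≤-trans (*-monoʳ (1 ÷ n) (0≤÷ 1 n) (u*ι≤1 d n n (n≤x d n))) (≤-reflexive (*-identityˡ (1 ÷ n))))
        Δ = ∣ γ D (H d n) - η D ∣
        bound : Δ ≤ ι 2 * L * (ℤ.+ 1 / n)
        bound = begin
          Δ                                ≡⟨ solve 1 (λ e → e := con (ι 2) :* (e :* con ½)) refl Δ ⟩
          ι 2 * (Δ * ½)                    ≤⟨ *-monoˡ (ι 2) (0≤ι 2) (*-monoˡ Δ (0≤∣p∣ (γ D (H d n) - η D)) ½≤p) ⟩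
          ι 2 * (Δ * p)                    ≡⟨ cong (λ q → ι 2 * (Δ * q)) (0≤p⇒∣p∣≡p (≤-trans (0≤÷ 1 2) ½≤p)) ⟨
          ι 2 * (Δ * ∣ p ∣)                ≡⟨ cong (ι 2 *_) (∣p*q∣≡∣p∣*∣q∣ (γ D (H d n) - η D) p) ⟨
          ι 2 * ∣ (γ D (H d n) - η D) * p ∣ ≤⟨ *-monoˡ (ι 2) (0≤ι 2) (≤-trans ∣difference∣≤ (*-monoˡ L 0≤L w≤1/n)) ⟩
          ι 2 * (L * (1 ÷ n))              ≡⟨ *-assoc (ι 2) L (1 ÷ n) ⟨
          ι 2 * L * (1 ÷ n)                ≡⟨ cong (ι 2 * L *_) (1÷≡ n) ⟩
          ι 2 * L * (ℤ.+ 1 / n) ∎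
          where open ≤-Reasoning

    -- The recursion of `α` multiplied by the factorial of the size of D: the denominator of the
    -- multinomial coefficient supplies the factorials that turn `α∅` into `η` at the branches.
    η-recursion : ∀ D → Dary d D → 2 ℕ.≤ leaves D → ∀ M → IsCompleteSetOfRepresentatives (branches d D) M →
      η (just D) ≡ multinomial (leaves D) (λ i → ‖ branches d D i ‖) * (length M ÷ (d ℕ.^ leaves D ℕ.∸ d)) * ∏ (λ i → η
          (branches d D i))
    η-recursion leaf _ (s≤s ())
    η-recursion D@(node (t ∷ ts)) (internal _ ≤d _) 2≤ M comp = begin
      ι (leaves D !) * (coefficient d D * α* d ds)
        ≡⟨ cong₂ (λ l A → ι (leaves D !) * ((l ÷ E) * A)) (length-representatives B (proj₂ (representatives B)) comp)
             (trans (α*≡∏ˡ d ds) (sym (∏-branches (α∅ d) refl ds ≤d))) ⟩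
      ι (leaves D !) * ((length M ÷ E) * A)
        ≡⟨ cong (_* ((length M ÷ E) * A)) (÷-* (leaves D !) F {{F≢0 (λ i → ‖ B i ‖)}}) ⟨
      (leaves D ! ÷ F) * ι F * ((length M ÷ E) * A)
        ≡⟨ solve 4 (λ m F c A → m :* F :* (c :* A) := m :* c :* (F :* A)) refl (leaves D ! ÷ F) (ι F) (length M ÷ E) A ⟩
      (leaves D ! ÷ F) * (length M ÷ E) * (ι F * A)
        ≡⟨ cong ((leaves D ! ÷ F) * (length M ÷ E) *_) (trans (cong (_* A) (ι-∏ (λ i → ‖ B i ‖ !))) (sym
            (Prod.∑-distrib-+ (λ i → ι (‖ B i ‖ !)) (λ i → α∅ d (B i))))) ⟩
      (leaves D ! ÷ F) * (length M ÷ E) * ∏ (λ i → η (B i)) ∎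
      where
      open ≡-Reasoning
      ds = t ∷ ts
      B = branches d D
      E = d ℕ.^ leaves D ℕ.∸ d
      F = foldr ℕ._*_ 1 (λ i → ‖ B i ‖ !)
      A = ∏ (λ i → α∅ d (B i))
      F≢0 : ∀ {k} (f : Vector ℕ k) → NonZero (foldr ℕ._*_ 1 (λ i → f i !))
      F≢0 {zero}  f = _
      F≢0 {suc k} f = ℕP.m*n≢0 (f zero !) _ {{f zero ℕP.!≢0}} {{F≢0 (f ∘ suc)}}

open import Data.Nat using (ℕ; _≤_; _^_; _∸_; NonTrivial)
open import Data.Rational using (ℚ; 1ℚ; _*_; _-_)
open Limit using (η; g~α∅; γ-IsO; IsO⇒⟶; η-recursion)

theorem2 : (d : ℕ) .{{_ : NonTrivial d}} →
    Σ[ η ∈ (Tree∅ → ℚ) ]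
    (∀ D → Dary∅ d D → (λ n → γ D (H d n)) ⟶ η D)
    × η nothing ≡ 1ℚ
    × η (just leaf) ≡ 1ℚ
    × (∀ D → Dary d D → 2 ≤ leaves D →
    ∀ M → IsCompleteSetOfRepresentatives (branches d D) M →
    η (just D) ≡ multinomial (leaves D) (λ i → ‖ branches d D i ‖)
    * (length M ÷ (d ^ leaves D ∸ d))
    * ∏ (λ i → η (branches d D i)))
    × (∀ D → Dary∅ d D → IsO[1/n] (λ n → γ D (H d n) - η D))
theorem2 d = η d
  , (λ D D-dary → IsO⇒⟶ (λ n → γ D (H d n)) (η d D) (γ-IsO d D (g~α∅ d D-dary)))
  , refl
  , refl
  , η-recursion d
  , (λ D D-dary → γ-IsO d D (g~α∅ d D-dary))
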